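{- For every integer $k\ge 1$, the function $M\mapsto \chi^k_M(t_1,\dots,t_k)\in\mathbb{Z}[t_1,\dots,t_k]$ is a matroid valuation.
   Context: A matroid $M=(\mathcal{A},\mathrm{rk})$ is given by a finite ground set $\mathcal{A}$ and its rank function $\mathrm{rk}$; $\mathrm{rk}(M)=\mathrm{rk}(\mathcal{A})$. For $k\ge 1$ let $\mathcal{C}^k_{\mathcal{A}}=\{(A_1,\dots,A_k)\in(2^{\mathcal{A}})^k \mid A_1\subseteq A_2\subseteq\cdots\subseteq A_k\subseteq\mathcal{A}\}$ (inclusions need not be strict). The $k$th chain characteristic polynomial is $\chi_M^k(t_1,\dots,t_k)=\sum_{(A_i)\in\mathcal{C}^k_{\mathcal{A}}}\prod_{i=1}^k(-1)^{|A_i|}t_i^{\mathrm{rk}(M)-\mathrm{rk}(A_i)}$. Matroid valuation: for a matroid $M$ on ground set $\mathcal{A}$, let $P(M)\subset\mathbb{R}^{\mathcal{A}}$ be its base polytope, the convex hull of the indicator vectors $\sum_{b\in B}e_b$ of the bases $B$ of $M$, and let $\mathbf{1}_{P(M)}:\mathbb{R}^{\mathcal{A}}\to\mathbb{Z}$ be the indicator function of $P(M)$. A function $f$ from matroids to an abelian group is a matroid valuation if for every finite set $\mathcal{A}$, all matroids $M_1,\dots,M_m$ on the ground set $\mathcal{A}$ and all integers $c_1,\dots,c_m$ with $\sum_i c_i\mathbf{1}_{P(M_i)}=0$, one has $\sum_i c_i f(M_i)=0$. -}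

module Defs where

open import Algebra.Bundles using (AbelianGroup)
import Algebra.Definitions.RawMonoid as RawMonoidDefs
open import Data.Bool.Base using (if_then_else_)
open import Data.Fin.Base using (Fin)
open import Data.Fin.Subset using (Subset; inside; outside; ⊤; ∣_∣; _⊆_; _∪_; _∩_)
open import Data.Fin.Subset.Properties using (_⊆?_)
open import Data.Integer.Base as ℤ using (ℤ; 0ℤ; 1ℤ; -1ℤ; +_; -[1+_])
import Data.Integer.Properties as ℤ
open import Data.List.Base as List using (List; []; _∷_; _++_)
import Data.List.Properties as List
open import Data.Nat.Base as ℕ using (ℕ; zero; suc; _⊔_)
import Data.Nat.Properties as ℕ
open import Data.Product.Base using (Σ; ∃; ∃-syntax; _×_; _,_)
open import Data.Rational.Base as ℚ using (ℚ; 0ℚ; 1ℚ; ½)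
import Data.Rational.Properties as ℚ
open import Data.Rational.Solver using (module +-*-Solver)
open import Data.Vec.Base as Vec using (Vec; []; _∷_; lookup)
import Data.Vec.Functional as Fun
import Data.Vec.Properties as Vec
open import Data.Vec.Relation.Unary.Linked using (Linked; linked?)
open import Level using (Level; 0ℓ) renaming (_⊔_ to _⊔ˡ_)
open import Relation.Binary.PropositionalEquality
open import Relation.Nullary using (Dec; yes; no; does)

-- The ground set is Fin n.
record Matroid (n : ℕ) : Set where
  field
    rk            : Subset n → ℕ
    rk-bounded    : ∀ X → rk X ℕ.≤ ∣ X ∣
    rk-monotone   : ∀ {X Y} → X ⊆ Y → rk X ℕ.≤ rk Y
    rk-submodular : ∀ X Y → rk (X ∪ Y) ℕ.+ rk (X ∩ Y) ℕ.≤ rk X ℕ.+ rk Y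

  rank : ℕ
  rank = rk ⊤

  Independent : Subset n → Set
  Independent X = rk X ≡ ∣ X ∣

  IsBasis : Subset n → Set
  IsBasis B = Independent B × (∀ {X} → Independent X → B ⊆ X → X ≡ B)

Eventually : (ℕ → Set) → Set
Eventually P = ∃[ N ] (∀ n → N ℕ.≤ n → P n)

IsCauchy : (ℕ → ℚ) → Set
IsCauchy s = ∀ ε → 0ℚ ℚ.< ε →
  ∃[ N ] (∀ m n → N ℕ.≤ m → N ℕ.≤ n → ℚ.∣ s m ℚ.- s n ∣ ℚ.< ε)

-- The reals as Cauchy sequences of rationals; equality of reals is _≈ᴿ_.
record ℝ : Set where
  constructor real
  field
    seq    : ℕ → ℚ
    cauchy : IsCauchy seq

open ℝ public

infix 4 _≈ᴿ_ _≤ᴿ_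

_≈ᴿ_ : ℝ → ℝ → Set
x ≈ᴿ y = ∀ ε → 0ℚ ℚ.< ε → Eventually λ n → ℚ.∣ seq x n ℚ.- seq y n ∣ ℚ.< ε

_≤ᴿ_ : ℝ → ℝ → Set
x ≤ᴿ y = ∀ ε → 0ℚ ℚ.< ε → Eventually λ n → seq x n ℚ.< seq y n ℚ.+ ε

const-cauchy : ∀ q → IsCauchy (λ _ → q)
const-cauchy q ε 0<ε =
  0 , λ _ _ _ _ → subst (λ r → ℚ.∣ r ∣ ℚ.< ε) (sym (ℚ.+-inverseʳ q)) 0<ε

half-pos : ∀ {ε} → 0ℚ ℚ.< ε → 0ℚ ℚ.< ½ ℚ.* ε
half-pos 0<ε = ℚ.*-monoʳ-<-pos ½ 0<ε

half+half : ∀ ε → ½ ℚ.* ε ℚ.+ ½ ℚ.* ε ≡ ε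
half+half ε = trans (sym (ℚ.*-distribʳ-+ ε ½ ½)) (ℚ.*-identityˡ ε)

+-cauchy : ∀ {s t} → IsCauchy s → IsCauchy t → IsCauchy (λ n → s n ℚ.+ t n)
+-cauchy {s} {t} cs ct ε 0<ε with cs (½ ℚ.* ε) (half-pos 0<ε) | ct (½ ℚ.* ε) (half-pos 0<ε)
... | N , p | N′ , p′ = N ⊔ N′ , λ m n m≥ n≥ → begin-strict
    ℚ.∣ (s m ℚ.+ t m) ℚ.- (s n ℚ.+ t n) ∣
  ≡⟨ cong ℚ.∣_∣ (regroup (s m) (t m) (s n) (t n)) ⟩
    ℚ.∣ (s m ℚ.- s n) ℚ.+ (t m ℚ.- t n) ∣
  ≤⟨ ℚ.∣p+q∣≤∣p∣+∣q∣ (s m ℚ.- s n) (t m ℚ.- t n) ⟩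
    ℚ.∣ s m ℚ.- s n ∣ ℚ.+ ℚ.∣ t m ℚ.- t n ∣
  <⟨ ℚ.+-mono-< (p m n (ℕ.m⊔n≤o⇒m≤o N N′ m≥) (ℕ.m⊔n≤o⇒m≤o N N′ n≥))
                (p′ m n (ℕ.m⊔n≤o⇒n≤o N N′ m≥) (ℕ.m⊔n≤o⇒n≤o N N′ n≥)) ⟩
    ½ ℚ.* ε ℚ.+ ½ ℚ.* ε
  ≡⟨ half+half ε ⟩
    ε ∎
  where
  open ℚ.≤-Reasoning
  open +-*-Solver
  regroup : ∀ a b c d → (a ℚ.+ b) ℚ.- (c ℚ.+ d) ≡ (a ℚ.- c) ℚ.+ (b ℚ.- d)
  regroup = solve 4 (λ a b c d → (a :+ b) :- (c :+ d) := (a :- c) :+ (b :- d)) refl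

cauchy-bounded : ∀ {s} → IsCauchy s →
  ∃[ K ] (0ℚ ℚ.< K × Eventually λ n → ℚ.∣ s n ∣ ℚ.< K)
cauchy-bounded {s} cs with cs 1ℚ (ℚ.positive⁻¹ 1ℚ)
... | N , p = 1ℚ ℚ.+ ℚ.∣ s N ∣
            , ℚ.+-mono-<-≤ (ℚ.positive⁻¹ 1ℚ) (ℚ.0≤∣p∣ (s N))
            , N , λ n n≥ → begin-strict
    ℚ.∣ s n ∣
  ≡⟨ cong ℚ.∣_∣ (regroup (s n) (s N)) ⟩
    ℚ.∣ (s n ℚ.- s N) ℚ.+ s N ∣
  ≤⟨ ℚ.∣p+q∣≤∣p∣+∣q∣ (s n ℚ.- s N) (s N) ⟩
    ℚ.∣ s n ℚ.- s N ∣ ℚ.+ ℚ.∣ s N ∣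
  <⟨ ℚ.+-monoˡ-< ℚ.∣ s N ∣ (p n N n≥ ℕ.≤-refl) ⟩
    1ℚ ℚ.+ ℚ.∣ s N ∣ ∎
  where
  open ℚ.≤-Reasoning
  open +-*-Solver
  regroup : ∀ a b → a ≡ (a ℚ.- b) ℚ.+ b
  regroup = solve 2 (λ a b → a := (a :- b) :+ b) refl

scale : ∀ {K ε} → 0ℚ ℚ.< K → 0ℚ ℚ.< ε → ∃[ δ ] (0ℚ ℚ.< δ × K ℚ.* δ ≡ ε)
scale {K} {ε} 0<K 0<ε = K⁻¹ ℚ.* ε
  , subst (ℚ._< K⁻¹ ℚ.* ε) (ℚ.*-zeroʳ K⁻¹)
      (ℚ.*-monoʳ-<-pos K⁻¹ {{ℚ.1/pos⇒pos K {{ℚ.positive 0<K}}}} 0<ε)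
  , trans (sym (ℚ.*-assoc K K⁻¹ ε))
      (trans (cong (ℚ._* ε) (ℚ.*-inverseʳ K {{K≢0}})) (ℚ.*-identityˡ ε))
  where
  K≢0 : ℚ.NonZero K
  K≢0 = ℚ.pos⇒nonZero K {{ℚ.positive 0<K}}
  K⁻¹ : ℚ
  K⁻¹ = (ℚ.1/ K) {{K≢0}}

*-bound : ∀ {p q K δ} → 0ℚ ℚ.< K → ℚ.∣ p ∣ ℚ.< K → ℚ.∣ q ∣ ℚ.< δ →
          ℚ.∣ p ℚ.* q ∣ ℚ.< K ℚ.* δ
*-bound {p} {q} {K} {δ} 0<K p<K q<δ = begin-strict
    ℚ.∣ p ℚ.* q ∣
  ≡⟨ ℚ.∣p*q∣≡∣p∣*∣q∣ p q ⟩
    ℚ.∣ p ∣ ℚ.* ℚ.∣ q ∣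
  ≤⟨ ℚ.*-monoʳ-≤-nonNeg ℚ.∣ q ∣ {{ℚ.nonNegative (ℚ.0≤∣p∣ q)}} (ℚ.<⇒≤ p<K) ⟩
    K ℚ.* ℚ.∣ q ∣
  <⟨ ℚ.*-monoʳ-<-pos K {{ℚ.positive 0<K}} q<δ ⟩
    K ℚ.* δ ∎
  where open ℚ.≤-Reasoning

*-difference-bound : ∀ a b c d {K K′ δ δ′} → 0ℚ ℚ.< K → 0ℚ ℚ.< K′ →
  ℚ.∣ a ∣ ℚ.< K → ℚ.∣ d ∣ ℚ.< K′ → ℚ.∣ b ℚ.- d ∣ ℚ.< δ → ℚ.∣ a ℚ.- c ∣ ℚ.< δ′ →
  ℚ.∣ a ℚ.* b ℚ.- c ℚ.* d ∣ ℚ.< K ℚ.* δ ℚ.+ K′ ℚ.* δ′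
*-difference-bound a b c d {K} {K′} {δ} {δ′} 0<K 0<K′ a<K d<K′ b-d<δ a-c<δ′ = begin-strict
    ℚ.∣ a ℚ.* b ℚ.- c ℚ.* d ∣
  ≡⟨ cong ℚ.∣_∣ regroup ⟩
    ℚ.∣ a ℚ.* (b ℚ.- d) ℚ.+ d ℚ.* (a ℚ.- c) ∣
  ≤⟨ ℚ.∣p+q∣≤∣p∣+∣q∣ (a ℚ.* (b ℚ.- d)) (d ℚ.* (a ℚ.- c)) ⟩
    ℚ.∣ a ℚ.* (b ℚ.- d) ∣ ℚ.+ ℚ.∣ d ℚ.* (a ℚ.- c) ∣
  <⟨ ℚ.+-mono-< left right ⟩
    K ℚ.* δ ℚ.+ K′ ℚ.* δ′ ∎
  where
  open ℚ.≤-Reasoning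
  open +-*-Solver
  left : ℚ.∣ a ℚ.* (b ℚ.- d) ∣ ℚ.< K ℚ.* δ
  left = *-bound {p = a} {q = b ℚ.- d} 0<K a<K b-d<δ
  right : ℚ.∣ d ℚ.* (a ℚ.- c) ∣ ℚ.< K′ ℚ.* δ′
  right = *-bound {p = d} {q = a ℚ.- c} 0<K′ d<K′ a-c<δ′
  expand : ∀ p q r → p ℚ.* (q ℚ.- r) ≡ p ℚ.* q ℚ.- p ℚ.* r
  expand p q r = trans (ℚ.*-distribˡ-+ p q (ℚ.- r))
    (cong (p ℚ.* q ℚ.+_) (sym (ℚ.neg-distribʳ-* p r)))
  telescope : ∀ p q r → (p ℚ.- q) ℚ.+ (q ℚ.- r) ≡ p ℚ.- r
  telescope = solve 3 (λ p q r → (p :- q) :+ (q :- r) := p :- r) refl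
  regroup : a ℚ.* b ℚ.- c ℚ.* d ≡ a ℚ.* (b ℚ.- d) ℚ.+ d ℚ.* (a ℚ.- c)
  regroup = sym (begin-equality
      a ℚ.* (b ℚ.- d) ℚ.+ d ℚ.* (a ℚ.- c)
    ≡⟨ cong₂ ℚ._+_ (expand a b d) (expand d a c) ⟩
      (a ℚ.* b ℚ.- a ℚ.* d) ℚ.+ (d ℚ.* a ℚ.- d ℚ.* c)
    ≡⟨ cong₂ (λ u v → (a ℚ.* b ℚ.- a ℚ.* d) ℚ.+ (u ℚ.- v)) (ℚ.*-comm d a) (ℚ.*-comm d c) ⟩
      (a ℚ.* b ℚ.- a ℚ.* d) ℚ.+ (a ℚ.* d ℚ.- c ℚ.* d)
    ≡⟨ telescope (a ℚ.* b) (a ℚ.* d) (c ℚ.* d) ⟩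
      a ℚ.* b ℚ.- c ℚ.* d ∎)

*-cauchy : ∀ {s t} → IsCauchy s → IsCauchy t → IsCauchy (λ n → s n ℚ.* t n)
*-cauchy {s} {t} cs ct ε 0<ε =
  let K  , 0<K  , M  , b  = cauchy-bounded cs
      K′ , 0<K′ , M′ , b′ = cauchy-bounded ct
      δ  , 0<δ  , Kδ≡     = scale 0<K (half-pos 0<ε)
      δ′ , 0<δ′ , K′δ′≡   = scale 0<K′ (half-pos 0<ε)
      N  , p              = cs δ′ 0<δ′
      N′ , p′             = ct δ 0<δ
      sum≡                = trans (cong₂ ℚ._+_ Kδ≡ K′δ′≡) (half+half ε)
  in (M ⊔ M′) ⊔ (N ⊔ N′) , λ m n m≥ n≥ →
    let m≥M⊔M′ = ℕ.m⊔n≤o⇒m≤o (M ⊔ M′) (N ⊔ N′) m≥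
        n≥M⊔M′ = ℕ.m⊔n≤o⇒m≤o (M ⊔ M′) (N ⊔ N′) n≥
        m≥N⊔N′ = ℕ.m⊔n≤o⇒n≤o (M ⊔ M′) (N ⊔ N′) m≥
        n≥N⊔N′ = ℕ.m⊔n≤o⇒n≤o (M ⊔ M′) (N ⊔ N′) n≥
    in subst (ℚ.∣ s m ℚ.* t m ℚ.- s n ℚ.* t n ∣ ℚ.<_) sum≡
      (*-difference-bound (s m) (t m) (s n) (t n) 0<K 0<K′
        (b m (ℕ.m⊔n≤o⇒m≤o M M′ m≥M⊔M′))
        (b′ n (ℕ.m⊔n≤o⇒n≤o M M′ n≥M⊔M′))
        (p′ m n (ℕ.m⊔n≤o⇒n≤o N N′ m≥N⊔N′) (ℕ.m⊔n≤o⇒n≤o N N′ n≥N⊔N′))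
        (p m n (ℕ.m⊔n≤o⇒m≤o N N′ m≥N⊔N′) (ℕ.m⊔n≤o⇒m≤o N N′ n≥N⊔N′)))

0ᴿ 1ᴿ : ℝ
0ᴿ = real (λ _ → 0ℚ) (const-cauchy 0ℚ)
1ᴿ = real (λ _ → 1ℚ) (const-cauchy 1ℚ)

infixl 6 _+ᴿ_
infixl 7 _*ᴿ_

_+ᴿ_ _*ᴿ_ : ℝ → ℝ → ℝ
x +ᴿ y = real (λ n → seq x n ℚ.+ seq y n) (+-cauchy {seq x} {seq y} (cauchy x) (cauchy y))
x *ᴿ y = real (λ n → seq x n ℚ.* seq y n) (*-cauchy {seq x} {seq y} (cauchy x) (cauchy y))

sumᴿ : ∀ {m} → (Fin m → ℝ) → ℝ
sumᴿ = Fun.foldr _+ᴿ_ 0ᴿ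

Point : ℕ → Set
Point n = Fin n → ℝ

_≈ᴾ_ : ∀ {n} → Point n → Point n → Set
x ≈ᴾ y = ∀ a → x a ≈ᴿ y a

ConvexHull : ∀ {n} → (Point n → Set) → Point n → Set
ConvexHull {n} S x =
  Σ ℕ λ m → Σ (Fin m → Point n) λ p → Σ (Fin m → ℝ) λ w →
    (∀ j → S (p j)) × (∀ j → 0ᴿ ≤ᴿ w j) × (sumᴿ w ≈ᴿ 1ᴿ) ×
    (x ≈ᴾ λ a → sumᴿ λ j → w j *ᴿ p j a)

indicatorVector : ∀ {n} → Subset n → Point n
indicatorVector B a = if lookup B a then 1ᴿ else 0ᴿ

BasePolytope : ∀ {n} → Matroid n → Point n → Set
BasePolytope M = ConvexHull λ y → ∃[ B ] (Matroid.IsBasis M B × (y ≈ᴾ indicatorVector B))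

-- The value of an indicator function at a point, given a decision of membership.
𝟏 : ∀ {a} {A : Set a} → Dec A → ℤ
𝟏 d = if does d then 1ℤ else 0ℤ

open RawMonoidDefs ℤ.+-0-rawMonoid using () renaming (sum to sumᶻ)

-- Constructively, membership of a real point in a polytope need not be
-- decidable, so 1_P is not available as a total ℤ-valued function.  The
-- hypothesis below says that the combination vanishes at x for every decision
-- of the memberships of x; under excluded middle each membership is
-- decidable and 𝟏 (d i) is the value of the indicator function of P(Mᵢ) at x.
IndicatorsCancel : ∀ {n m} → (Fin m → Matroid n) → (Fin m → ℤ) → Set
IndicatorsCancel M c =
  ∀ x (d : ∀ i → Dec (BasePolytope (M i) x)) → sumᶻ (λ i → c i ℤ.* 𝟏 (d i)) ≡ 0ℤ

module _ {g ℓ : Level} (G : AbelianGroup g ℓ) where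
  open AbelianGroup G
  open RawMonoidDefs rawMonoid using (sum) renaming (_×_ to _×ᴳ_)

  infixr 8 _·_
  _·_ : ℤ → Carrier → Carrier
  (+ n)    · x = n ×ᴳ x
  -[1+ n ] · x = (suc n ×ᴳ x) ⁻¹

  IsMatroidValuation : (∀ {n} → Matroid n → Carrier) → Set ℓ
  IsMatroidValuation f =
    ∀ n m (M : Fin m → Matroid n) (c : Fin m → ℤ) →
    IndicatorsCancel M c → sum (λ i → c i · f (M i)) ≈ ε

-- ℤ[t₁,…,tₖ]: a polynomial is a formal sum of terms c·t^e, represented by the pair (c , e);
-- exponents may repeat, and two sums are identified by _≈ᵖ_ when all
-- collected coefficients agree.
Poly : ℕ → Set
Poly k = List (ℤ × Vec ℕ k)

termCoeff : ∀ {k} → ℤ × Vec ℕ k → Vec ℕ k → ℤ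
termCoeff (c , e′) e = if does (Vec.≡-dec ℕ._≟_ e′ e) then c else 0ℤ

coeff : ∀ {k} → Poly k → Vec ℕ k → ℤ
coeff []      e = 0ℤ
coeff (t ∷ p) e = termCoeff t e ℤ.+ coeff p e

infix  4 _≈ᵖ_
infixl 6 _+ᵖ_
infixl 7 _*ᵖ_
infixr 8 _^ᵖ_

_≈ᵖ_ : ∀ {k} → Poly k → Poly k → Set
p ≈ᵖ q = ∀ e → coeff p e ≡ coeff q e

constᵖ : ∀ {k} → ℤ → Poly k
constᵖ c = (c , Vec.replicate _ 0) ∷ []

0ᵖ 1ᵖ : ∀ {k} → Poly k
0ᵖ = []
1ᵖ = constᵖ 1ℤ

var : ∀ {k} → Fin k → Poly k
var i = (1ℤ , Vec.replicate _ 0 Vec.[ i ]≔ 1) ∷ []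

_+ᵖ_ _*ᵖ_ : ∀ {k} → Poly k → Poly k → Poly k
_+ᵖ_ = _++_
_*ᵖ_ = List.cartesianProductWith λ (c , e) (c′ , e′) → c ℤ.* c′ , Vec.zipWith ℕ._+_ e e′

-ᵖ_ : ∀ {k} → Poly k → Poly k
-ᵖ_ = List.map λ (c , e) → ℤ.- c , e

_^ᵖ_ : ∀ {k} → Poly k → ℕ → Poly k
p ^ᵖ zero  = 1ᵖ
p ^ᵖ suc n = p *ᵖ p ^ᵖ n

prodᵖ : ∀ {k m} → (Fin m → Poly k) → Poly k
prodᵖ = Fun.foldr _*ᵖ_ 1ᵖ

coeff-+ : ∀ {k} (p q : Poly k) e → coeff (p +ᵖ q) e ≡ coeff p e ℤ.+ coeff q e
coeff-+ []      q e = sym (ℤ.+-identityˡ (coeff q e))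
coeff-+ (t ∷ p) q e =
  trans (cong (ℤ._+_ (termCoeff t e)) (coeff-+ p q e))
        (sym (ℤ.+-assoc (termCoeff t e) (coeff p e) (coeff q e)))

coeff-neg : ∀ {k} (p : Poly k) e → coeff (-ᵖ p) e ≡ ℤ.- coeff p e
coeff-neg []                e = refl
coeff-neg (t@(c , e′) ∷ p) e =
  trans (cong₂ ℤ._+_ head (coeff-neg p e)) (sym (ℤ.neg-distrib-+ (termCoeff t e) (coeff p e)))
  where
  head : termCoeff (ℤ.- c , e′) e ≡ ℤ.- termCoeff t e
  head with Vec.≡-dec ℕ._≟_ e′ e
  ... | yes _ = refl
  ... | no  _ = refl

polyAbelianGroup : ℕ → AbelianGroup 0ℓ 0ℓ
polyAbelianGroup k = record
  { Carrier = Poly k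
  ; _≈_     = _≈ᵖ_
  ; _∙_     = _+ᵖ_
  ; ε       = 0ᵖ
  ; _⁻¹     = -ᵖ_
  ; isAbelianGroup = record
    { isGroup = record
      { isMonoid = record
        { isSemigroup = record
          { isMagma = record
            { isEquivalence = record
              { refl  = λ _ → refl
              ; sym   = λ p≈q e → sym (p≈q e)
              ; trans = λ p≈q q≈r e → trans (p≈q e) (q≈r e)
              }
            ; ∙-cong = λ {p} {q} {r} {s} p≈q r≈s e →
                trans (coeff-+ p r e)
                  (trans (cong₂ ℤ._+_ (p≈q e) (r≈s e)) (sym (coeff-+ q s e)))
            }
          ; assoc = λ p q r e → cong (λ s → coeff s e) (List.++-assoc p q r)
          }
        ; identity = (λ _ _ → refl)
                   , (λ p e → cong (λ s → coeff s e) (List.++-identityʳ p))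
        }
      ; inverse = (λ p e → trans (coeff-+ (-ᵖ p) p e)
                    (trans (cong (ℤ._+ coeff p e) (coeff-neg p e)) (ℤ.+-inverseˡ (coeff p e))))
                , (λ p e → trans (coeff-+ p (-ᵖ p) e)
                    (trans (cong (ℤ._+_ (coeff p e)) (coeff-neg p e)) (ℤ.+-inverseʳ (coeff p e))))
      ; ⁻¹-cong = λ {p} {q} p≈q e →
          trans (coeff-neg p e) (trans (cong ℤ.-_ (p≈q e)) (sym (coeff-neg q e)))
      }
    ; comm = λ p q e → trans (coeff-+ p q e)
        (trans (ℤ.+-comm (coeff p e) (coeff q e)) (sym (coeff-+ q p e)))
    }
  }

-- All vectors of length k with entries from a list, each once if the list has no repeats.
vectorsOver : ∀ {a} {A : Set a} → List A → (k : ℕ) → List (Vec A k)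
vectorsOver xs zero    = [] ∷ []
vectorsOver xs (suc k) = List.cartesianProductWith _∷_ xs (vectorsOver xs k)

subsets : ∀ n → List (Subset n)
subsets = vectorsOver (outside ∷ inside ∷ [])

chains : ∀ k n → List (Vec (Subset n) k)
chains k n = List.filter (linked? _⊆?_) (vectorsOver (subsets n) k)

-- The truncated subtraction is exact, since rk A ≤ rank by monotonicity.
chainCharPoly : ∀ k {n} → Matroid n → Poly k
chainCharPoly k {n} M = List.foldr _+ᵖ_ 0ᵖ (List.map term (chains k n))
  where
  open Matroid M
  term : Vec (Subset n) k → Poly k
  term A = prodᵖ λ i →
    constᵖ (-1ℤ ℤ.^ ∣ lookup A i ∣) *ᵖ var i ^ᵖ (rank ℕ.∸ rk (lookup A i))

{-# OPTIONS --safe #-}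

-- A linear relation between the indicator functions of polytopes forces the same relation between
-- the truth values of "the polytope is nonempty". By induction on the dimension this holds for the
-- slices at x₀ = t, whose nonemptiness, as a function of t, is the indicator function of an interval;
-- and on a line the Euler characteristic takes the value 1 at every nonempty closed interval.
--
-- Adjoin to the points x of P(M) the value w(x) of an integral functional w as a new coordinate.
-- Slicing at w = c and at w = c - ½ and subtracting shows that M ↦ [min of w over P(M) is c] is a
-- valuation. For a chain A₁ ⊆ … ⊆ Aₖ and w(x) = Σⱼ Nʲ⁻¹ x(E ∖ Aⱼ), a greedily chosen basis spans
-- every Aⱼ, so the minimum is Σⱼ Nʲ⁻¹ (rk M − rk Aⱼ). For large N its digits are the exponents of the
-- term of the chain, hence the coefficients of χᵏ are valuations.
--
-- Only rational points are tested. The slices of the hull of finitely many rational points are again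
-- such hulls, and Fourier–Motzkin elimination yields for every rational point outside a hull a
-- separating rational functional, which excludes real convex combinations too.
module Submission where

open import Defs
open import Algebra.Bundles using (module CommutativeRing)
import Algebra.Properties.Semiring.Mult as SemiringMult
import Algebra.Properties.Semiring.Sum as SemiringSum
open import Data.Bool.Base using (true; false; if_then_else_)
open import Data.Fin.Base using (Fin; zero; suc)
open import Data.Fin.Subset as Subset
  using (Subset; inside; outside; ⊤; ⊥; ⁅_⁆; ∁; ∣_∣; _⊆_; _∪_; _∩_; _─_)
open import Data.Fin.Subset.Properties as Subset using (_∈?_; _⊆?_)
open import Data.Integer.Base as ℤ using (ℤ; 0ℤ; 1ℤ; -1ℤ; +_; -[1+_])
import Data.Integer.Properties as ℤ
open import Data.List.Base as List using (List; []; _∷_)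
import Data.List.Extrema as Extrema
open import Data.List.Membership.Propositional using (_∈_; find)
open import Data.List.Membership.Propositional.Properties
  using (∈-allFin; ∈-cartesianProductWith⁺; ∈-cartesianProductWith⁻; ∈-concat⁺′; ∈-filter⁺; ∈-filter⁻;
         ∈-lookup; ∈-map⁺; ∈-map⁻; ∈-tabulate⁺)
open import Data.List.Relation.Binary.Permutation.Propositional using (↭-sym)
open import Data.List.Relation.Binary.Permutation.Propositional.Properties using (∈-resp-↭)
open import Data.List.Relation.Unary.All as All using ([]; _∷_)
open import Data.List.Relation.Unary.AllPairs using (AllPairs; _∷_)
open import Data.List.Relation.Unary.Any as Any using (here; there; index)
open import Data.List.Relation.Unary.Any.Properties using (lookup-index)
open import Data.List.Relation.Unary.Linked.Properties using (Linked⇒AllPairs)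
import Data.List.Sort as Sort
open import Data.Nat.Base as ℕ using (ℕ; zero; suc; _≤_)
import Data.Nat.DivMod as ℕ
import Data.Nat.Properties as ℕ
open import Data.Product.Base using (∃-syntax; _×_; _,_; proj₁; proj₂; map₂)
open import Data.Rational.Base as ℚ using (ℚ; 0ℚ; 1ℚ; ½)
import Data.Rational.Properties as ℚ
open import Data.Rational.Solver using (module +-*-Solver)
open import Data.Sum.Base as Sum using (_⊎_; inj₁; inj₂)
open import Data.Vec.Base as Vec using (Vec; []; _∷_; lookup)
open import Data.Vec.Functional as Fun using (Vector)
import Data.Vec.Properties as Vec
open import Data.Vec.Relation.Unary.All as VecAll using ([]; _∷_)
import Data.Vec.Relation.Unary.All.Properties as VecAll
open import Data.Vec.Relation.Unary.Linked using (Linked; []; [-]; _∷_; linked?)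
open import Function.Base using (_∘_; case_of_; id)
open import Relation.Binary.Bundles using (module DecTotalOrder)
open import Relation.Binary.Definitions using (tri<; tri≈; tri>)
open import Relation.Binary.PropositionalEquality
open import Relation.Nullary using (Dec; yes; no; does; ¬_; contradiction; _×-dec_)

open Extrema (DecTotalOrder.totalOrder ℚ.≤-decTotalOrder)
  using (max; min; argmax-sel; argmin-sel; ⊥≤max; xs≤max; min≤⊤; min≤xs)
open Sort ℚ.≤-decTotalOrder using (sort; sort-↭; sort-↗)
open +-*-Solver using (solve; con; _:=_; _:+_; _:-_; _:*_; :-_)

module Σℚ = SemiringSum (CommutativeRing.semiring ℚ.+-*-commutativeRing)
module Σℤ = SemiringSum ℤ.+-*-semiring
open Σℚ using () renaming (sum to sumℚ)
open SemiringMult (CommutativeRing.semiring ℚ.+-*-commutativeRing)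
  using (×-homo-+; ×1-homo-*) renaming (_×_ to _×ℚ_)

private variable
  d k m n : ℕ


-- Slices of rational hulls and separation

0≤q-p : ∀ {p q} → p ℚ.≤ q → 0ℚ ℚ.≤ q ℚ.- p
0≤q-p {p} {q} p≤q = subst (ℚ._≤ q ℚ.- p) (ℚ.+-inverseʳ p) (ℚ.+-monoˡ-≤ (ℚ.- p) p≤q)

0<q-p : ∀ {p q} → p ℚ.< q → 0ℚ ℚ.< q ℚ.- p
0<q-p {p} {q} p<q = subst (ℚ._< q ℚ.- p) (ℚ.+-inverseʳ p) (ℚ.+-monoˡ-< (ℚ.- p) p<q)

p+[q-p]≡q : ∀ p q → p ℚ.+ (q ℚ.- p) ≡ q
p+[q-p]≡q = solve 2 (λ p q → p :+ (q :- p) := q) refl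

0≤q-p⇒p≤q : ∀ {p q} → 0ℚ ℚ.≤ q ℚ.- p → p ℚ.≤ q
0≤q-p⇒p≤q {p} {q} 0≤ = subst₂ ℚ._≤_ (ℚ.+-identityʳ p) (p+[q-p]≡q p q) (ℚ.+-monoʳ-≤ p 0≤)

neg-involutive : ∀ p → ℚ.- (ℚ.- p) ≡ p
neg-involutive = solve 1 (λ p → :- (:- p) := p) refl

0≤+ : ∀ {p q} → 0ℚ ℚ.≤ p → 0ℚ ℚ.≤ q → 0ℚ ℚ.≤ p ℚ.+ q
0≤+ = ℚ.+-mono-≤

0≤* : ∀ {p q} → 0ℚ ℚ.≤ p → 0ℚ ℚ.≤ q → 0ℚ ℚ.≤ p ℚ.* q
0≤* {p} {q} 0≤p 0≤q = subst (ℚ._≤ p ℚ.* q) (ℚ.*-zeroʳ p)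
  (ℚ.*-monoˡ-≤-nonNeg p {{ℚ.nonNegative 0≤p}} 0≤q)

0≤p*q⇒0≤p : ∀ {p q} → 0ℚ ℚ.< q → 0ℚ ℚ.≤ p ℚ.* q → 0ℚ ℚ.≤ p
0≤p*q⇒0≤p {p} {q} 0<q 0≤pq = ℚ.*-cancelʳ-≤-pos q {{ℚ.positive 0<q}}
  (subst (ℚ._≤ p ℚ.* q) (sym (ℚ.*-zeroˡ q)) 0≤pq)

-- Division with p / 0 = 0.
quot : ℚ → ℚ → ℚ
quot p q with q ℚ.≟ 0ℚ
... | yes _   = 0ℚ
... | no  q≢0 = p ℚ.* ℚ.1/_ q {{ℚ.≢-nonZero q≢0}}

quot-0 : ∀ p → quot p 0ℚ ≡ 0ℚ
quot-0 p = refl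

quot-* : ∀ p {q} → q ≢ 0ℚ → quot p q ℚ.* q ≡ p
quot-* p {q} q≢0 with q ℚ.≟ 0ℚ
... | yes q≡0  = contradiction q≡0 q≢0
... | no  q≢0′ = trans (ℚ.*-assoc p _ q)
  (trans (cong (p ℚ.*_) (ℚ.*-inverseˡ q {{ℚ.≢-nonZero q≢0′}})) (ℚ.*-identityʳ p))

mix : ℚ → ℚ → ℚ → ℚ
mix μ p q = μ ℚ.* p ℚ.+ (1ℚ ℚ.- μ) ℚ.* q

-- The weight `μ` solving `μ p + (1 - μ) q = t`. For `p = t = q` every weight solves it, and the
-- default value of `quot` selects 0, which is still in the unit interval.
mixing : ℚ → ℚ → ℚ → ℚ
mixing t p q = quot (q ℚ.- t) (q ℚ.- p)

mix-idem : ∀ μ p → mix μ p p ≡ p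
mix-idem = solve 2 (λ μ p → μ :* p :+ (con 1ℚ :- μ) :* p := p) refl

mix-nonneg : ∀ {μ p q} → 0ℚ ℚ.≤ μ → μ ℚ.≤ 1ℚ → 0ℚ ℚ.≤ p → 0ℚ ℚ.≤ q → 0ℚ ℚ.≤ mix μ p q
mix-nonneg 0≤μ μ≤1 0≤p 0≤q = 0≤+ (0≤* 0≤μ 0≤p) (0≤* (0≤q-p μ≤1) 0≤q)

module _ {t p q} (p≤t : p ℚ.≤ t) (t≤q : t ℚ.≤ q) where
  private
    μ = mixing t p q

    case : (p ≡ q) ⊎ (0ℚ ℚ.< q ℚ.- p)
    case with ℚ.<-cmp p q
    ... | tri< p<q _ _ = inj₂ (0<q-p p<q)
    ... | tri≈ _ p≡q _ = inj₁ p≡q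
    ... | tri> _ _ q<p = contradiction (ℚ.≤-<-trans (ℚ.≤-trans p≤t t≤q) q<p) (ℚ.<-irrefl refl)

    degenerate : p ≡ q → μ ≡ 0ℚ
    degenerate refl = trans (cong (quot (q ℚ.- t)) (ℚ.+-inverseʳ p)) (quot-0 (q ℚ.- t))

    eq : 0ℚ ℚ.< q ℚ.- p → μ ℚ.* (q ℚ.- p) ≡ q ℚ.- t
    eq 0<  = quot-* (q ℚ.- t) (λ e → ℚ.<⇒≢ 0< (sym e))

  mixing-*  : μ ℚ.* (q ℚ.- p) ≡ q ℚ.- t
  mixing-* with case
  ... | inj₂ 0<   = eq 0<
  ... | inj₁ refl = trans (cong (μ ℚ.*_) (ℚ.+-inverseʳ p)) (trans (ℚ.*-zeroʳ μ)
          (trans (sym (ℚ.+-inverseʳ p)) (cong (λ z → p ℚ.- z) (ℚ.≤-antisym p≤t t≤q))))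

  0≤mixing : 0ℚ ℚ.≤ μ
  0≤mixing with case
  ... | inj₂ 0<  = 0≤p*q⇒0≤p 0< (subst (0ℚ ℚ.≤_) (sym (eq 0<)) (0≤q-p t≤q))
  ... | inj₁ p≡q = ℚ.≤-reflexive (sym (degenerate p≡q))

  mixing≤1 : μ ℚ.≤ 1ℚ
  mixing≤1 with case
  ... | inj₁ p≡q = subst (ℚ._≤ 1ℚ) (sym (degenerate p≡q)) (ℚ.nonNegative⁻¹ 1ℚ)
  ... | inj₂ 0<  = ℚ.*-cancelʳ-≤-pos (q ℚ.- p) {{ℚ.positive 0<}}
    (subst₂ ℚ._≤_ (sym (eq 0<)) (sym (ℚ.*-identityˡ (q ℚ.- p)))
      (ℚ.+-monoʳ-≤ q (ℚ.neg-antimono-≤ p≤t)))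

  mix-mixing : mix μ p q ≡ t
  mix-mixing = trans (regroup μ p q) (trans (cong (λ z → q ℚ.- z) mixing-*) (cancel q t))
    where
    regroup : ∀ μ p q → mix μ p q ≡ q ℚ.- μ ℚ.* (q ℚ.- p)
    regroup = solve 3 (λ μ p q → μ :* p :+ (con 1ℚ :- μ) :* q := q :- μ :* (q :- p)) refl
    cancel : ∀ q t → q ℚ.- (q ℚ.- t) ≡ t
    cancel = solve 2 (λ q t → q :- (q :- t) := t) refl

nonempty : ∀ {a} {A : Set a} → List A → ℤ
nonempty []      = 0ℤ
nonempty (_ ∷ _) = 1ℤ

crossing : ℚ → Vector ℚ (suc d) → Vector ℚ (suc d) → Vector ℚ d
crossing t u v a = mix (mixing t (u zero) (v zero)) (u (suc a)) (v (suc a))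

-- Generators of the slice {x₀ = t} of the convex hull of V, first coordinate dropped.
slice : ℚ → List (Vector ℚ (suc d)) → List (Vector ℚ d)
slice t V = List.cartesianProductWith (crossing t)
  (List.filter (λ v → v zero ℚ.≤? t) V) (List.filter (λ v → t ℚ.≤? v zero) V)

-- A point lies in the hull iff its tail lies in the slice at its first coordinate. Fixing one
-- coordinate after another leaves a list of points of dimension zero, so membership is computed as
-- the nonemptiness of a list.
hullIndicator : List (Vector ℚ d) → Vector ℚ d → ℤ
hullIndicator {zero}  V x = nonempty V
hullIndicator {suc d} V x = hullIndicator (slice (x zero) V) (Fun.tail x)

∈-slice⁺ : ∀ {t} {V : List (Vector ℚ (suc d))} {u v} → u ∈ V → v ∈ V →
           u zero ℚ.≤ t → t ℚ.≤ v zero → crossing t u v ∈ slice t V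
∈-slice⁺ {t = t} u∈V v∈V u≤t t≤v = ∈-cartesianProductWith⁺ (crossing t)
  (∈-filter⁺ (λ v → v zero ℚ.≤? t) u∈V u≤t) (∈-filter⁺ (λ v → t ℚ.≤? v zero) v∈V t≤v)

∈-slice⁻ : ∀ t (V : List (Vector ℚ (suc d))) {w} → w ∈ slice t V →
           ∃[ u ] ∃[ v ] (u ∈ V × v ∈ V × u zero ℚ.≤ t × t ℚ.≤ v zero × w ≡ crossing t u v)
∈-slice⁻ t V w∈ =
  let u , v , u∈ , v∈ , w≡ = ∈-cartesianProductWith⁻ (crossing t) _ _ w∈
      u∈V , u≤t = ∈-filter⁻ (λ v → v zero ℚ.≤? t) u∈
      v∈V , t≤v = ∈-filter⁻ (λ v → t ℚ.≤? v zero) v∈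
  in u , v , u∈V , v∈V , u≤t , t≤v , w≡

-- Points are functions, so `z` is only required to agree pointwise with the mixture. With `μ = 1`
-- this also makes `C` closed under pointwise equality.
IsConvex : (Vector ℚ d → Set) → Set
IsConvex C = ∀ {x y z} μ → 0ℚ ℚ.≤ μ → μ ℚ.≤ 1ℚ → C x → C y →
  (∀ a → z a ≡ mix μ (x a) (y a)) → C z

affine : ℚ → Vector ℚ d → Vector ℚ d → ℚ
affine β α x = β ℚ.+ sumℚ λ a → α a ℚ.* x a

Separated : List (Vector ℚ d) → Vector ℚ d → Set
Separated V x = ∃[ β ] ∃[ α ] ((∀ {v} → v ∈ V → 0ℚ ℚ.≤ affine β α v) × affine β α x ℚ.< 0ℚ)

affine-mix : ∀ β (α : Vector ℚ d) μ x y →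
  affine β α (λ a → mix μ (x a) (y a)) ≡ mix μ (affine β α x) (affine β α y)
affine-mix β α μ x y = trans (cong (β ℚ.+_) (linear α x y))
    (regroup β μ (sumℚ (λ a → α a ℚ.* x a)) (sumℚ (λ a → α a ℚ.* y a)))
  where
  regroup : ∀ β μ p q → β ℚ.+ mix μ p q ≡ mix μ (β ℚ.+ p) (β ℚ.+ q)
  regroup = solve 4 (λ β μ p q → β :+ (μ :* p :+ (con 1ℚ :- μ) :* q) :=
    μ :* (β :+ p) :+ (con 1ℚ :- μ) :* (β :+ q)) refl
  step : ∀ c μ p q r s → c ℚ.* mix μ p q ℚ.+ mix μ r s ≡ mix μ (c ℚ.* p ℚ.+ r) (c ℚ.* q ℚ.+ s)
  step = solve 6 (λ c μ p q r s →
    c :* (μ :* p :+ (con 1ℚ :- μ) :* q) :+ (μ :* r :+ (con 1ℚ :- μ) :* s) :=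
    μ :* (c :* p :+ r) :+ (con 1ℚ :- μ) :* (c :* q :+ s)) refl
  linear : ∀ {d} (α x y : Vector ℚ d) → sumℚ (λ a → α a ℚ.* mix μ (x a) (y a)) ≡
    mix μ (sumℚ λ a → α a ℚ.* x a) (sumℚ λ a → α a ℚ.* y a)
  linear {zero}  α x y = sym (mix-idem μ 0ℚ)
  linear {suc d} α x y =
    trans (cong (α zero ℚ.* mix μ (x zero) (y zero) ℚ.+_) (linear (α ∘ suc) (x ∘ suc) (y ∘ suc)))
      (step (α zero) μ (x zero) (y zero) _ _)

-- The coefficient `α₀` tilts the functional about the hyperplane where the first coordinate is `t`;
-- the correction of `β` keeps the values on that hyperplane.
affine-∷ : ∀ β α₀ t (α : Vector ℚ d) x →
  affine (β ℚ.- α₀ ℚ.* t) (α₀ Fun.∷ α) x ≡ affine β α (Fun.tail x) ℚ.+ α₀ ℚ.* (x zero ℚ.- t)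
affine-∷ β α₀ t α x = regroup β α₀ t (x zero) (sumℚ λ a → α a ℚ.* x (suc a))
  where
  regroup : ∀ β a t p s →
    (β ℚ.- a ℚ.* t) ℚ.+ (a ℚ.* p ℚ.+ s) ≡ (β ℚ.+ s) ℚ.+ a ℚ.* (p ℚ.- t)
  regroup = solve 5 (λ β a t p s →
    (β :- a :* t) :+ (a :* p :+ s) := (β :+ s) :+ a :* (p :- t)) refl

-- Extrema and elimination of one unknown

maximum : ∀ p ps → ∃[ m ] (m ∈ p ∷ ps × (∀ {q} → q ∈ p ∷ ps → q ℚ.≤ m))
maximum p ps = max p ps , Any.fromSum (argmax-sel id p ps)
  , λ { (here refl) → ⊥≤max p ps ; (there q∈) → All.lookup (xs≤max p ps) q∈ }

minimum : ∀ p ps → ∃[ m ] (m ∈ p ∷ ps × (∀ {q} → q ∈ p ∷ ps → m ℚ.≤ q))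
minimum p ps = min p ps , Any.fromSum (argmin-sel id p ps)
  , λ { (here refl) → min≤⊤ p ps ; (there q∈) → All.lookup (min≤xs p ps) q∈ }

between : ∀ (L U : List ℚ) → (∀ {l u} → l ∈ L → u ∈ U → l ℚ.≤ u) →
  ∃[ r ] ((∀ {l} → l ∈ L → l ℚ.≤ r) × (∀ {u} → u ∈ U → r ℚ.≤ u))
between []       []       L≤U = 0ℚ , (λ ()) , (λ ())
between []       (u ∷ us) L≤U with minimum u us
... | m , _ , min = m , (λ ()) , min
between (l ∷ ls) U        L≤U with maximum l ls
... | m , m∈ , max = m , max , L≤U m∈

-- Fourier–Motzkin elimination of a single unknown.
slope : ∀ {a} {A : Set a} (V : List A) (f g : A → ℚ) →
  (∀ {v} → v ∈ V → g v ≡ 0ℚ → 0ℚ ℚ.≤ f v) →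
  (∀ {u v} → u ∈ V → v ∈ V → g u ℚ.< 0ℚ → 0ℚ ℚ.< g v →
    0ℚ ℚ.≤ g v ℚ.* f u ℚ.- g u ℚ.* f v) →
  ∃[ r ] (∀ {v} → v ∈ V → 0ℚ ℚ.≤ f v ℚ.+ r ℚ.* g v)
slope {A = A} V f g zeros pairs = r , bound
  where
  ratio : A → ℚ
  ratio v = quot (ℚ.- f v) (g v)
  -- Dividing `0 ≤ f v + r * g v` by `g v` makes `ratio v` a lower bound for `r` if `g v` is
  -- positive and an upper bound if `g v` is negative.
  L = List.filter (λ v → 0ℚ ℚ.<? g v) V
  U = List.filter (λ v → g v ℚ.<? 0ℚ) V
  ratio-* : ∀ v → g v ≢ 0ℚ → ratio v ℚ.* g v ≡ ℚ.- f v
  ratio-* v = quot-* (ℚ.- f v)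
  ordered : ∀ {l u} → l ∈ List.map ratio L → u ∈ List.map ratio U → l ℚ.≤ u
  ordered l∈ u∈ with ∈-map⁻ ratio l∈ | ∈-map⁻ ratio u∈
  ... | v , v∈ , refl | u , u∈ , refl =
    -- Multiplying `ratio u - ratio v` by the positive numbers `0 - g u` and `g v` clears both
    -- denominators and leaves the expression in `pairs`.
    0≤q-p⇒p≤q (0≤p*q⇒0≤p (0<q-p gu<0) (0≤p*q⇒0≤p 0<gv
      (subst (0ℚ ℚ.≤_) (sym scaled) (pairs u∈V v∈V gu<0 0<gv))))
    where
    v∈V = proj₁ (∈-filter⁻ (λ v → 0ℚ ℚ.<? g v) v∈)
    0<gv = proj₂ (∈-filter⁻ (λ v → 0ℚ ℚ.<? g v) {xs = V} v∈)
    u∈V = proj₁ (∈-filter⁻ (λ v → g v ℚ.<? 0ℚ) u∈)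
    gu<0 = proj₂ (∈-filter⁻ (λ v → g v ℚ.<? 0ℚ) {xs = V} u∈)
    regroup : ∀ ru rv gu gv → (ru ℚ.- rv) ℚ.* (0ℚ ℚ.- gu) ℚ.* gv ≡
      gv ℚ.* (ℚ.- (ru ℚ.* gu)) ℚ.- gu ℚ.* (ℚ.- (rv ℚ.* gv))
    regroup = solve 4 (λ ru rv gu gv → (ru :- rv) :* (con 0ℚ :- gu) :* gv :=
      gv :* (:- (ru :* gu)) :- gu :* (:- (rv :* gv))) refl
    scaled : (ratio u ℚ.- ratio v) ℚ.* (0ℚ ℚ.- g u) ℚ.* g v ≡ g v ℚ.* f u ℚ.- g u ℚ.* f v
    scaled = trans (regroup (ratio u) (ratio v) (g u) (g v))
      (cong₂ (λ p q → g v ℚ.* p ℚ.- g u ℚ.* q)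
        (trans (cong ℚ.-_ (ratio-* u (ℚ.<⇒≢ gu<0))) (neg-involutive (f u)))
        (trans (cong ℚ.-_ (ratio-* v (λ e → ℚ.<⇒≢ 0<gv (sym e)))) (neg-involutive (f v))))
  separator = between (List.map ratio L) (List.map ratio U) ordered
  r = proj₁ separator
  L≤r = proj₁ (proj₂ separator)
  r≤U = proj₂ (proj₂ separator)
  split : ∀ r q g → (r ℚ.- q) ℚ.* g ≡ (ℚ.- (q ℚ.* g)) ℚ.+ r ℚ.* g
  split = solve 3 (λ r q g → (r :- q) :* g := (:- (q :* g)) :+ r :* g) refl
  split′ : ∀ r q g → (q ℚ.- r) ℚ.* (0ℚ ℚ.- g) ≡ (ℚ.- (q ℚ.* g)) ℚ.+ r ℚ.* g
  split′ = solve 3 (λ r q g → (q :- r) :* (con 0ℚ :- g) := (:- (q :* g)) :+ r :* g) refl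
  bound : ∀ {v} → v ∈ V → 0ℚ ℚ.≤ f v ℚ.+ r ℚ.* g v
  bound {v} v∈V with ℚ.<-cmp (g v) 0ℚ
  ... | tri≈ _ gv≡0 _ = subst (0ℚ ℚ.≤_) (sym (trans (cong (λ z → f v ℚ.+ r ℚ.* z) gv≡0)
          (trans (cong (f v ℚ.+_) (ℚ.*-zeroʳ r)) (ℚ.+-identityʳ (f v))))) (zeros v∈V gv≡0)
  ... | tri< gv<0 _ _ = subst (0ℚ ℚ.≤_)
          (trans (split′ r (ratio v) (g v)) (cong (ℚ._+ r ℚ.* g v)
            (trans (cong ℚ.-_ (ratio-* v (ℚ.<⇒≢ gv<0))) (neg-involutive (f v)))))
          (0≤* (0≤q-p (r≤U (∈-map⁺ ratio (∈-filter⁺ (λ v → g v ℚ.<? 0ℚ) v∈V gv<0))))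
               (ℚ.<⇒≤ (0<q-p gv<0)))
  ... | tri> _ _ 0<gv = subst (0ℚ ℚ.≤_)
          (trans (split r (ratio v) (g v)) (cong (ℚ._+ r ℚ.* g v)
            (trans (cong ℚ.-_ (ratio-* v (λ e → ℚ.<⇒≢ 0<gv (sym e)))) (neg-involutive (f v)))))
          (0≤* (0≤q-p (L≤r (∈-map⁺ ratio (∈-filter⁺ (λ v → 0ℚ ℚ.<? g v) v∈V 0<gv))))
               (ℚ.<⇒≤ 0<gv))

-- The functional for the slice is tilted about the slicing hyperplane until it is nonnegative on
-- all of `V`. Each generator imposes one linear inequality on the slope, and two generators on
-- opposite sides are compatible because the functional is nonnegative at their crossing point.
slice-separated : ∀ (V : List (Vector ℚ (suc d))) x →
  Separated (slice (x zero) V) (Fun.tail x) → Separated V x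
slice-separated V x (β , α , nonneg , neg) =
  let α₀ , bound = slope V f g zeros pairs in
  β ℚ.- α₀ ℚ.* t , α₀ Fun.∷ α
  , (λ {v} v∈V → subst (0ℚ ℚ.≤_) (sym (affine-∷ β α₀ t α v)) (bound v∈V))
  , subst (ℚ._< 0ℚ) (sym (trans (affine-∷ β α₀ t α x) (atx α₀))) neg
  where
  t = x zero
  f g : Vector ℚ _ → ℚ
  f v = affine β α (Fun.tail v)
  g v = v zero ℚ.- t
  atx : ∀ α₀ → f x ℚ.+ α₀ ℚ.* (x zero ℚ.- t) ≡ f x
  atx α₀ = trans (cong (λ z → f x ℚ.+ α₀ ℚ.* z) (ℚ.+-inverseʳ t))
    (trans (cong (f x ℚ.+_) (ℚ.*-zeroʳ α₀)) (ℚ.+-identityʳ (f x)))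
  onCrossing : ∀ {u v} → u ∈ V → v ∈ V → u zero ℚ.≤ t → t ℚ.≤ v zero →
    0ℚ ℚ.≤ mix (mixing t (u zero) (v zero)) (f u) (f v)
  onCrossing {u} {v} u∈V v∈V u≤t t≤v = subst (0ℚ ℚ.≤_)
    (affine-mix β α (mixing t (u zero) (v zero)) (Fun.tail u) (Fun.tail v))
    (nonneg (∈-slice⁺ u∈V v∈V u≤t t≤v))
  v≡t : ∀ v → g v ≡ 0ℚ → v zero ≡ t
  v≡t v e = trans (sym (p+[q-p]≡q t (v zero))) (trans (cong (t ℚ.+_) e) (ℚ.+-identityʳ t))
  -- A generator on the hyperplane crosses it with itself, so its tail is a generator of the slice
  -- up to `mix-idem`.
  zeros : ∀ {v} → v ∈ V → g v ≡ 0ℚ → 0ℚ ℚ.≤ f v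
  zeros {v} v∈V gv≡0 = subst (0ℚ ℚ.≤_) (mix-idem (mixing t (v zero) (v zero)) (f v))
    (onCrossing v∈V v∈V (ℚ.≤-reflexive (v≡t v gv≡0)) (ℚ.≤-reflexive (sym (v≡t v gv≡0))))
  below : ∀ {p} → p ℚ.- t ℚ.< 0ℚ → p ℚ.< t
  below {p} p-t<0 = subst₂ ℚ._<_ (p+[q-p]≡q t p) (ℚ.+-identityʳ t) (ℚ.+-monoʳ-< t p-t<0)
  above : ∀ {p} → 0ℚ ℚ.< p ℚ.- t → t ℚ.< p
  above {p} 0<p-t = subst₂ ℚ._<_ (ℚ.+-identityʳ t) (p+[q-p]≡q t p) (ℚ.+-monoʳ-< t 0<p-t)
  -- Multiplying the value at the crossing point by `v zero - u zero` turns its weights into `g v`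
  -- and `- g u`.
  pairs : ∀ {u v} → u ∈ V → v ∈ V → g u ℚ.< 0ℚ → 0ℚ ℚ.< g v →
    0ℚ ℚ.≤ g v ℚ.* f u ℚ.- g u ℚ.* f v
  pairs {u} {v} u∈V v∈V gu<0 0<gv = subst (0ℚ ℚ.≤_) scaled
      (0≤* (onCrossing u∈V v∈V u≤t t≤v) (0≤q-p (ℚ.≤-trans u≤t t≤v)))
    where
    u≤t = ℚ.<⇒≤ (below gu<0)
    t≤v = ℚ.<⇒≤ (above 0<gv)
    μ = mixing t (u zero) (v zero)
    regroup : ∀ μ p q u v → mix μ p q ℚ.* (v ℚ.- u) ≡
      μ ℚ.* (v ℚ.- u) ℚ.* p ℚ.+ ((v ℚ.- u) ℚ.- μ ℚ.* (v ℚ.- u)) ℚ.* q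
    regroup = solve 5 (λ μ p q u v → (μ :* p :+ (con 1ℚ :- μ) :* q) :* (v :- u) :=
      μ :* (v :- u) :* p :+ ((v :- u) :- μ :* (v :- u)) :* q) refl
    finish : ∀ p q u v t → (v ℚ.- t) ℚ.* p ℚ.+ ((v ℚ.- u) ℚ.- (v ℚ.- t)) ℚ.* q ≡
      (v ℚ.- t) ℚ.* p ℚ.- (u ℚ.- t) ℚ.* q
    finish = solve 5 (λ p q u v t → (v :- t) :* p :+ ((v :- u) :- (v :- t)) :* q :=
      (v :- t) :* p :- (u :- t) :* q) refl
    scaled : mix μ (f u) (f v) ℚ.* (v zero ℚ.- u zero) ≡ g v ℚ.* f u ℚ.- g u ℚ.* f v
    scaled = trans (regroup μ (f u) (f v) (u zero) (v zero))
      (trans (cong (λ z → z ℚ.* f u ℚ.+ ((v zero ℚ.- u zero) ℚ.- z) ℚ.* f v) (mixing-* u≤t t≤v))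
        (finish (f u) (f v) (u zero) (v zero) t))

-- Membership is expressed by all convex sets containing the generators, so that no weights are
-- carried through the recursion and a suitable `C` can be chosen at each use. Nonmembership comes
-- with a certificate that can also be tested against real combinations.
hullIndicator-spec : ∀ (V : List (Vector ℚ d)) x →
  (hullIndicator V x ≡ 1ℤ × (∀ {C} → IsConvex C → (∀ {v} → v ∈ V → C v) → C x)) ⊎
  (hullIndicator V x ≡ 0ℤ × Separated V x)
hullIndicator-spec {zero}  []      x =
  -- Without generators the constant functional -1 separates.
  inj₂ (refl , ℚ.- 1ℚ , (λ ()) , (λ ()) , ℚ.negative⁻¹ _)
hullIndicator-spec {zero}  (v ∷ V) x = inj₁ (refl , λ {C} conv V⊆C →
  conv 1ℚ (ℚ.nonNegative⁻¹ 1ℚ) ℚ.≤-refl (V⊆C (here refl)) (V⊆C (here refl)) (λ ()))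
hullIndicator-spec {suc d} V x with hullIndicator-spec (slice (x zero) V) (Fun.tail x)
... | inj₂ (≡0 , sep) = inj₂ (≡0 , slice-separated V x sep)
... | inj₁ (≡1 , hull) = inj₁ (≡1 , λ {C} conv V⊆C →
    -- The section of `C` by the hyperplane through `x` is convex and contains the generators of the
    -- slice, so the induction hypothesis applies to it.
    respects conv (λ { zero → refl ; (suc a) → refl }) (hull {λ y → C (x zero Fun.∷ y)}
      (λ {y} {y′} μ 0≤μ μ≤1 Cy Cy′ z≡ → conv μ 0≤μ μ≤1 Cy Cy′
        λ { zero → sym (mix-idem μ (x zero)) ; (suc a) → z≡ a })
      (λ w∈ → inSlice conv V⊆C w∈)))
  where
  respects : ∀ {C : Vector ℚ (suc d) → Set} → IsConvex C → ∀ {y z} → (∀ a → z a ≡ y a) → C y → C z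
  respects conv z≡y Cy = conv 1ℚ (ℚ.nonNegative⁻¹ 1ℚ) ℚ.≤-refl Cy Cy
    λ a → trans (z≡y a) (sym (mix-idem 1ℚ _))
  inSlice : ∀ {C : Vector ℚ (suc d) → Set} → IsConvex C → (∀ {v} → v ∈ V → C v) →
    ∀ {w} → w ∈ slice (x zero) V → C (x zero Fun.∷ w)
  inSlice conv V⊆C w∈ with ∈-slice⁻ (x zero) V w∈
  ... | u , v , u∈V , v∈V , u≤t , t≤v , refl =
    conv _ (0≤mixing u≤t t≤v) (mixing≤1 u≤t t≤v) (V⊆C u∈V) (V⊆C v∈V)
      λ { zero → sym (mix-mixing u≤t t≤v) ; (suc a) → refl }

-- Euler characteristic

combination : Vector ℤ m → Vector ℤ m → ℤ
combination c f = Σℤ.sum λ i → c i ℤ.* f i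

combination-cong : ∀ (c : Vector ℤ m) {f g} → (∀ i → f i ≡ g i) → combination c f ≡ combination c g
combination-cong c f≗g = Σℤ.sum-cong-≗ λ i → cong (c i ℤ.*_) (f≗g i)

combination-+ : ∀ (c f g : Vector ℤ m) →
  combination c (λ i → f i ℤ.+ g i) ≡ combination c f ℤ.+ combination c g
combination-+ c f g = trans (Σℤ.sum-cong-≗ λ i → ℤ.*-distribˡ-+ (c i) (f i) (g i))
  (Σℤ.∑-distrib-+ (λ i → c i ℤ.* f i) (λ i → c i ℤ.* g i))

combination-*ʳ : ∀ (c f : Vector ℤ m) k →
  combination c (λ i → f i ℤ.* k) ≡ combination c f ℤ.* k
combination-*ʳ c f k = trans (Σℤ.sum-cong-≗ λ i → sym (ℤ.*-assoc (c i) (f i) k))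
  (sym (Σℤ.*-distribʳ-sum k λ i → c i ℤ.* f i))

combination-0 : ∀ (c : Vector ℤ m) → combination c (λ _ → 0ℤ) ≡ 0ℤ
combination-0 {m} c = trans (Σℤ.sum-cong-≗ λ i → ℤ.*-zeroʳ (c i)) (Σℤ.sum-replicate-zero m)

combination-minus : ∀ (c f g : Vector ℤ m) →
  combination c (λ i → f i ℤ.- g i) ≡ combination c f ℤ.- combination c g
combination-minus c f g = begin
  combination c (λ i → f i ℤ.- g i)
    ≡⟨ combination-cong c (λ i → cong (ℤ._+_ (f i)) (trans (sym (ℤ.-1*i≡-i (g i))) (ℤ.*-comm _ (g i)))) ⟩
  combination c (λ i → f i ℤ.+ g i ℤ.* -1ℤ)
    ≡⟨ combination-+ c f _ ⟩
  combination c f ℤ.+ combination c (λ i → g i ℤ.* -1ℤ)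
    ≡⟨ cong (ℤ._+_ (combination c f)) (trans (combination-*ʳ c g -1ℤ)
         (trans (ℤ.*-comm _ -1ℤ) (ℤ.-1*i≡-i _))) ⟩
  combination c f ℤ.- combination c g ∎
  where open ≡-Reasoning

mid : ℚ → ℚ → ℚ
mid p q = ½ ℚ.* (p ℚ.+ q)

mid-idem : ∀ p → mid p p ≡ p
mid-idem p = trans (ℚ.*-distribˡ-+ ½ p p) (half+half p)

mid-≤ : ∀ {p q r} → p ℚ.≤ r → q ℚ.≤ r → mid p q ℚ.≤ r
mid-≤ {r = r} p≤r q≤r = subst (_ ℚ.≤_) (mid-idem r) (ℚ.*-monoˡ-≤-nonNeg ½ (ℚ.+-mono-≤ p≤r q≤r))

≤-mid : ∀ {p q r} → r ℚ.≤ p → r ℚ.≤ q → r ℚ.≤ mid p q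
≤-mid {r = r} r≤p r≤q = subst (ℚ._≤ _) (mid-idem r) (ℚ.*-monoˡ-≤-nonNeg ½ (ℚ.+-mono-≤ r≤p r≤q))

mid-< : ∀ {p q r} → p ℚ.< r → q ℚ.≤ r → mid p q ℚ.< r
mid-< {r = r} p<r q≤r = subst (_ ℚ.<_) (mid-idem r) (ℚ.*-monoʳ-<-pos ½ (ℚ.+-mono-<-≤ p<r q≤r))

<-mid : ∀ {p q r} → r ℚ.≤ p → r ℚ.< q → r ℚ.< mid p q
<-mid {r = r} r≤p r<q = subst (ℚ._< _) (mid-idem r) (ℚ.*-monoʳ-<-pos ½ (ℚ.+-mono-≤-< r≤p r<q))

-- The Euler characteristic of g if the points are sorted and include all jumps of g.
euler : (ℚ → ℤ) → List ℚ → ℤ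
euler g []           = 0ℤ
euler g (p ∷ [])     = g p
euler g (p ∷ q ∷ ps) = (g p ℤ.- g (mid p q)) ℤ.+ euler g (q ∷ ps)

-- For a fixed list of points `euler` is a fixed linear expression in values of `g`.
euler-combination : ∀ (c : Vector ℤ m) (g : Fin m → ℚ → ℤ) ps →
  (∀ t → combination c (λ i → g i t) ≡ 0ℤ) → combination c (λ i → euler (g i) ps) ≡ 0ℤ
euler-combination c g []           g≡0 = combination-0 c
euler-combination c g (p ∷ [])     g≡0 = g≡0 p
euler-combination c g (p ∷ q ∷ ps) g≡0 = trans (combination-+ c _ _)
  (cong₂ ℤ._+_ (trans (combination-minus c _ _) (cong₂ ℤ._-_ (g≡0 p) (g≡0 (mid p q))))
    (euler-combination c g (q ∷ ps) g≡0))

euler-0 : ∀ g ps → (∀ t → g t ≡ 0ℤ) → euler g ps ≡ 0ℤ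
euler-0 g []           g≡0 = refl
euler-0 g (p ∷ [])     g≡0 = g≡0 p
euler-0 g (p ∷ q ∷ ps) g≡0 =
  cong₂ ℤ._+_ (cong₂ ℤ._-_ (g≡0 p) (g≡0 (mid p q))) (euler-0 g (q ∷ ps) g≡0)

head-≤ : ∀ {p ps r} → AllPairs ℚ._≤_ (p ∷ ps) → r ∈ p ∷ ps → p ℚ.≤ r
head-≤ _        (here refl) = ℚ.≤-refl
head-≤ (p≤ ∷ _) (there r∈)  = All.lookup p≤ r∈

module _ (g : ℚ → ℤ) {a b : ℚ}
  (inside : ∀ {t} → a ℚ.≤ t → t ℚ.≤ b → g t ≡ 1ℤ)
  (below : ∀ {t} → t ℚ.< a → g t ≡ 0ℤ) (above : ∀ {t} → b ℚ.< t → g t ≡ 0ℤ) where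

  euler-above : ∀ {p ps} → AllPairs ℚ._≤_ (p ∷ ps) → b ℚ.< p → euler g (p ∷ ps) ≡ 0ℤ
  euler-above {ps = []}     _                      b<p = above b<p
  euler-above {ps = q ∷ ps} ((p≤q ∷ _) ∷ sorted) b<p = cong₂ ℤ._+_
    (cong₂ ℤ._-_ (above b<p) (above (<-mid (ℚ.<⇒≤ b<p) b<q))) (euler-above sorted b<q)
    where b<q = ℚ.<-≤-trans b<p p≤q

  euler-inside : ∀ {p ps} → AllPairs ℚ._≤_ (p ∷ ps) → a ℚ.≤ p → p ℚ.≤ b → b ∈ p ∷ ps →
    euler g (p ∷ ps) ≡ 1ℤ
  euler-inside {ps = []}         _                      a≤p p≤b _  = inside a≤p p≤b
  euler-inside {p} {ps = q ∷ ps} ((p≤q ∷ _) ∷ sorted) a≤p p≤b b∈ with q ℚ.≤? b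
  ... | yes q≤b = cong₂ ℤ._+_
    (cong₂ ℤ._-_ (inside a≤p p≤b) (inside (≤-mid a≤p a≤q) (mid-≤ p≤b q≤b)))
    (euler-inside sorted a≤q q≤b (b∈tail b∈))
    where
    a≤q = ℚ.≤-trans a≤p p≤q
    b∈tail : b ∈ p ∷ q ∷ ps → b ∈ q ∷ ps
    b∈tail (here refl) = here (ℚ.≤-antisym p≤q q≤b)
    b∈tail (there b∈)  = b∈
  -- Since `b` is listed and `q` already exceeds it, `b ≤ p`; hence the midpoint lies beyond `b`,
  -- and this is the one gap that contributes 1 - 0.
  ... | no q≰b = cong₂ ℤ._+_
    (cong₂ ℤ._-_ (inside a≤p p≤b) (above (<-mid (b≤p b∈) b<q))) (euler-above sorted b<q)
    where
    b<q = ℚ.≰⇒> q≰b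
    b≤p : b ∈ p ∷ q ∷ ps → b ℚ.≤ p
    b≤p (here refl) = ℚ.≤-refl
    b≤p (there b∈)  = contradiction (head-≤ sorted b∈) q≰b

  -- Gaps before `a` contribute 0 - 0 and gaps between `a` and `b` contribute 1 - 1, so only the
  -- last occurrence of `b` counts. A repeated point is its own midpoint and contributes nothing.
  euler-interval : ∀ {ps} → AllPairs ℚ._≤_ ps → a ∈ ps → b ∈ ps → a ℚ.≤ b → euler g ps ≡ 1ℤ
  euler-interval sorted (here refl) b∈ a≤b = euler-inside sorted ℚ.≤-refl a≤b b∈
  euler-interval {p ∷ q ∷ ps} (p≤ ∷ sorted) (there a∈) b∈ a≤b with ℚ.<-cmp p a
  ... | tri≈ _ refl _ = euler-inside (p≤ ∷ sorted) ℚ.≤-refl a≤b b∈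
  ... | tri> _ _ a<p  = contradiction (ℚ.<-≤-trans a<p (All.lookup p≤ a∈)) (ℚ.<-irrefl refl)
  ... | tri< p<a _ _  = cong₂ ℤ._+_
    (cong₂ ℤ._-_ (below p<a) (below (mid-< p<a (head-≤ sorted a∈))))
    (euler-interval sorted a∈ (b∈tail b∈) a≤b)
    where
    b∈tail : b ∈ p ∷ q ∷ ps → b ∈ q ∷ ps
    b∈tail (here refl) = contradiction (ℚ.<-≤-trans p<a a≤b) (ℚ.<-irrefl refl)
    b∈tail (there b∈)  = b∈

nonempty≡1 : ∀ {a} {A : Set a} {xs : List A} {x} → x ∈ xs → nonempty xs ≡ 1ℤ
nonempty≡1 (here _)  = refl
nonempty≡1 (there _) = refl

nonempty≡0 : ∀ {a} {A : Set a} (xs : List A) → (∀ {x} → ¬ x ∈ xs) → nonempty xs ≡ 0ℤ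
nonempty≡0 []       _   = refl
nonempty≡0 (x ∷ xs) ∉xs = contradiction (here refl) ∉xs

nonempty-slice≡1 : ∀ {t} {V : List (Vector ℚ (suc d))} {u v} → u ∈ V → v ∈ V →
  u zero ℚ.≤ t → t ℚ.≤ v zero → nonempty (slice t V) ≡ 1ℤ
nonempty-slice≡1 {V = V} u∈V v∈V u≤t t≤v = nonempty≡1 (∈-slice⁺ {V = V} u∈V v∈V u≤t t≤v)

nonempty-slice-below : ∀ {t} (V : List (Vector ℚ (suc d))) →
  (∀ {v} → v ∈ V → t ℚ.< v zero) → nonempty (slice t V) ≡ 0ℤ
nonempty-slice-below {t = t} V t< = nonempty≡0 _ λ w∈ →
  let u , _ , u∈V , _ , u≤t , _ = ∈-slice⁻ t V w∈ in ℚ.<-irrefl refl (ℚ.<-≤-trans (t< u∈V) u≤t)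

nonempty-slice-above : ∀ {t} (V : List (Vector ℚ (suc d))) →
  (∀ {v} → v ∈ V → v zero ℚ.< t) → nonempty (slice t V) ≡ 0ℤ
nonempty-slice-above {t = t} V <t = nonempty≡0 _ λ w∈ →
  let _ , v , _ , v∈V , _ , t≤v , _ = ∈-slice⁻ t V w∈ in ℚ.<-irrefl refl (ℚ.<-≤-trans (<t v∈V) t≤v)

-- For nonempty `V` the slice at `t` is nonempty exactly when `t` lies between the least and the
-- greatest first coordinate, and `heads∈` puts both ends among the points.
euler-slices : ∀ (V : List (Vector ℚ (suc d))) {ps} → AllPairs ℚ._≤_ ps →
  (∀ {v} → v ∈ V → v zero ∈ ps) → euler (λ t → nonempty (slice t V)) ps ≡ nonempty V
euler-slices []         {ps} sorted heads∈ = euler-0 _ ps λ _ → refl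
euler-slices V@(v ∷ vs) {ps} sorted heads∈
  with minimum (Fun.head v) (List.map Fun.head vs) | maximum (Fun.head v) (List.map Fun.head vs)
... | a , a∈ , min | b , b∈ , max with ∈-map⁻ Fun.head {xs = V} a∈ | ∈-map⁻ Fun.head {xs = V} b∈
... | u , u∈ , refl | w , w∈ , refl = euler-interval _
  (nonempty-slice≡1 u∈ w∈)
  (λ t<a → nonempty-slice-below V λ v∈ → ℚ.<-≤-trans t<a (min (∈-map⁺ Fun.head v∈)))
  (λ b<t → nonempty-slice-above V λ v∈ → ℚ.≤-<-trans (max (∈-map⁺ Fun.head v∈)) b<t)
  sorted (heads∈ u∈) (heads∈ w∈) (min b∈)

-- By definition of `hullIndicator`, fixing the first coordinate of `x` turns the hypothesis into
-- the same hypothesis on the slices, one dimension lower.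
hullIndicators-cancel⇒nonempty-cancel : ∀ (V : Fin m → List (Vector ℚ d)) c →
  (∀ x → combination c (λ i → hullIndicator (V i) x) ≡ 0ℤ) → combination c (λ i → nonempty (V i)) ≡ 0ℤ
hullIndicators-cancel⇒nonempty-cancel {d = zero}  V c cancel = cancel λ ()
hullIndicators-cancel⇒nonempty-cancel {d = suc d} V c cancel = trans
  (combination-cong c λ i → sym (euler-slices (V i) sorted (heads∈ i)))
  (euler-combination c (λ i t → nonempty (slice t (V i))) points λ t →
    hullIndicators-cancel⇒nonempty-cancel (slice t ∘ V) c λ x → cancel (t Fun.∷ x))
  where
  -- Linearity needs one list of points for all `i`, so the first coordinates of all generators are
  -- pooled.
  points = sort (List.concat (List.tabulate λ i → List.map Fun.head (V i)))
  sorted = Linked⇒AllPairs ℚ.≤-trans (sort-↗ _)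
  heads∈ : ∀ i {v} → v ∈ V i → Fun.head v ∈ points
  heads∈ i v∈ = ∈-resp-↭ (↭-sym (sort-↭ _))
    (∈-concat⁺′ (∈-map⁺ Fun.head v∈) (∈-tabulate⁺ {f = λ i → List.map Fun.head (V i)} i))

-- Real convex hulls

sum-mix : ∀ μ (f g : Vector ℚ m) →
  sumℚ (λ j → mix μ (f j) (g j)) ≡ mix μ (sumℚ f) (sumℚ g)
sum-mix μ f g = trans (Σℚ.∑-distrib-+ (λ j → μ ℚ.* f j) (λ j → (1ℚ ℚ.- μ) ℚ.* g j))
  (sym (cong₂ ℚ._+_ (Σℚ.*-distribˡ-sum μ f) (Σℚ.*-distribˡ-sum (1ℚ ℚ.- μ) g)))

RationalHull : (Fin m → Vector ℚ d) → Vector ℚ d → Set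
RationalHull {m} q x = ∃[ w ] ((∀ j → 0ℚ ℚ.≤ w j) × sumℚ {m} w ≡ 1ℚ ×
  (∀ a → x a ≡ sumℚ λ j → w j ℚ.* q j a))

rationalHull-convex : (q : Fin m → Vector ℚ d) → IsConvex (RationalHull q)
rationalHull-convex q {x} {y} {z} μ 0≤μ μ≤1 (w , 0≤w , Σw≡1 , x≡) (w′ , 0≤w′ , Σw′≡1 , y≡) z≡ =
  (λ j → mix μ (w j) (w′ j)) , (λ j → mix-nonneg 0≤μ μ≤1 (0≤w j) (0≤w′ j))
  , trans (sum-mix μ w w′) (trans (cong₂ (mix μ) Σw≡1 Σw′≡1) (mix-idem μ 1ℚ))
  , λ a → trans (z≡ a) (trans (cong₂ (mix μ) (x≡ a) (y≡ a))
      (trans (sym (sum-mix μ (λ j → w j ℚ.* q j a) (λ j → w′ j ℚ.* q j a)))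
        (Σℚ.sum-cong-≗ λ j → mix-* μ (w j) (w′ j) (q j a))))
  where
  mix-* : ∀ μ p q r → mix μ (p ℚ.* r) (q ℚ.* r) ≡ mix μ p q ℚ.* r
  mix-* = solve 4 (λ μ p q r →
    μ :* (p :* r) :+ (con 1ℚ :- μ) :* (q :* r) := (μ :* p :+ (con 1ℚ :- μ) :* q) :* r) refl

kronecker : Fin m → Vector ℚ m
kronecker zero    zero    = 1ℚ
kronecker zero    (suc j) = 0ℚ
kronecker (suc i) zero    = 0ℚ
kronecker (suc i) (suc j) = kronecker i j

0≤kronecker : ∀ (i j : Fin m) → 0ℚ ℚ.≤ kronecker i j
0≤kronecker zero    zero    = ℚ.nonNegative⁻¹ 1ℚ
0≤kronecker zero    (suc j) = ℚ.≤-refl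
0≤kronecker (suc i) zero    = ℚ.≤-refl
0≤kronecker (suc i) (suc j) = 0≤kronecker i j

sum-0* : ∀ (f : Vector ℚ m) → sumℚ (λ j → 0ℚ ℚ.* f j) ≡ 0ℚ
sum-0* f = trans (sym (Σℚ.*-distribˡ-sum 0ℚ f)) (ℚ.*-zeroˡ (sumℚ f))

sum-kronecker : ∀ i (f : Vector ℚ m) → sumℚ (λ j → kronecker i j ℚ.* f j) ≡ f i
sum-kronecker zero    f = trans
  (cong₂ ℚ._+_ (ℚ.*-identityˡ (f zero)) (sum-0* (f ∘ suc)))
  (ℚ.+-identityʳ (f zero))
sum-kronecker (suc i) f = trans
  (cong₂ ℚ._+_ (ℚ.*-zeroˡ (f zero)) (sum-kronecker i (f ∘ suc)))
  (ℚ.+-identityˡ (f (suc i)))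

generator∈rationalHull : ∀ (q : Fin m → Vector ℚ d) i → RationalHull q (q i)
generator∈rationalHull q i = kronecker i , 0≤kronecker i
  , trans (Σℚ.sum-cong-≗ λ j → sym (ℚ.*-identityʳ (kronecker i j))) (sum-kronecker i (λ _ → 1ℚ))
  , λ a → sym (sum-kronecker i λ j → q j a)

constant : ℚ → ℝ
constant q = real (λ _ → q) (const-cauchy q)

pointwise⇒≈ᴿ : ∀ x y → (∀ k → seq x k ≡ seq y k) → x ≈ᴿ y
pointwise⇒≈ᴿ x y x≗y ε 0<ε = 0 , λ k _ → subst (λ r → ℚ.∣ r ∣ ℚ.< ε)
  (sym (trans (cong (ℚ._- seq y k) (x≗y k)) (ℚ.+-inverseʳ (seq y k)))) 0<ε

seq-sum : ∀ (f : Fin m → ℝ) k → seq (sumᴿ f) k ≡ sumℚ λ j → seq (f j) k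
seq-sum {zero}  f k = refl
seq-sum {suc m} f k = cong (seq (f zero) k ℚ.+_) (seq-sum (f ∘ suc) k)

indicator : Subset n → Vector ℚ n
indicator B a = if lookup B a then 1ℚ else 0ℚ

seq-indicatorVector : ∀ (B : Subset n) a k → seq (indicatorVector B a) k ≡ indicator B a
seq-indicatorVector B a k with lookup B a
... | true  = refl
... | false = refl

rationalHull⇒basePolytope : ∀ (M : Matroid n) (B : Fin m → Subset n) {x} →
  (∀ j → Matroid.IsBasis M (B j)) → RationalHull (indicator ∘ B) x → BasePolytope M (constant ∘ x)
rationalHull⇒basePolytope {m = m} M B {x} basis (w , 0≤w , Σw≡1 , x≡) =
  m , indicatorVector ∘ B , constant ∘ w
  , (λ j → B j , basis j , λ a → pointwise⇒≈ᴿ (indicatorVector (B j) a) (indicatorVector (B j) a) λ _ → refl)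
  , (λ j ε 0<ε → 0 , λ _ _ → ℚ.+-mono-≤-< (0≤w j) 0<ε)
  , pointwise⇒≈ᴿ (sumᴿ (constant ∘ w)) 1ᴿ (λ k → trans (seq-sum (constant ∘ w) k) Σw≡1)
  , λ a → pointwise⇒≈ᴿ (constant (x a)) (sumᴿ λ j → constant (w j) *ᴿ indicatorVector (B j) a) λ k →
      trans (x≡ a) (trans
        (Σℚ.sum-cong-≗ λ j → cong (w j ℚ.*_) (sym (seq-indicatorVector (B j) a k)))
        (sym (seq-sum (λ j → constant (w j) *ᴿ indicatorVector (B j) a) k)))

-- Limits of rational sequences

Null : (ℕ → ℚ) → Set
Null s = ∀ ε → 0ℚ ℚ.< ε → Eventually λ k → ℚ.∣ s k ∣ ℚ.< ε

-- For `s = seq y` this unfolds to `0ᴿ ≤ᴿ y`; stated for sequences, it spares Cauchy proofs for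
-- intermediate expressions.
AsymptoticallyNonneg : (ℕ → ℚ) → Set
AsymptoticallyNonneg s = ∀ ε → 0ℚ ℚ.< ε → Eventually λ k → 0ℚ ℚ.< s k ℚ.+ ε

eventually₂ : ∀ {P Q R : ℕ → Set} → (∀ k → P k → Q k → R k) →
  Eventually P → Eventually Q → Eventually R
eventually₂ f (N , p) (N′ , q) = N ℕ.⊔ N′ , λ k k≥ →
  f k (p k (ℕ.m⊔n≤o⇒m≤o N N′ k≥)) (q k (ℕ.m⊔n≤o⇒n≤o N N′ k≥))

null-respects : ∀ {s t : ℕ → ℚ} → (∀ k → s k ≡ t k) → Null s → Null t
null-respects s≗t null ε 0<ε =
  let N , p = null ε 0<ε in N , λ k k≥ → subst (λ r → ℚ.∣ r ∣ ℚ.< ε) (s≗t k) (p k k≥)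

null-+ : ∀ s t → Null s → Null t → Null (λ k → s k ℚ.+ t k)
null-+ s t ns nt ε 0<ε = eventually₂
  (λ k p q → ℚ.≤-<-trans (ℚ.∣p+q∣≤∣p∣+∣q∣ (s k) (t k))
    (subst (ℚ.∣ s k ∣ ℚ.+ ℚ.∣ t k ∣ ℚ.<_) (half+half ε) (ℚ.+-mono-< p q)))
  (ns (½ ℚ.* ε) (half-pos 0<ε)) (nt (½ ℚ.* ε) (half-pos 0<ε))

null-0 : Null (λ _ → 0ℚ)
null-0 ε 0<ε = 0 , λ _ _ → 0<ε

null-sum : ∀ {s : Fin m → ℕ → ℚ} → (∀ j → Null (s j)) → Null (λ k → sumℚ λ j → s j k)
null-sum {zero}  ns = null-0
null-sum {suc m} {s} ns =
  null-+ (s zero) (λ k → sumℚ λ j → s (suc j) k) (ns zero) (null-sum (ns ∘ suc))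

null-* : ∀ s t → IsCauchy s → Null t → Null (λ k → s k ℚ.* t k)
null-* s t cs nt ε 0<ε =
  let K , 0<K , bounded = cauchy-bounded {s} cs
      δ , 0<δ , Kδ≡ε = scale 0<K 0<ε
  in eventually₂ (λ k p q → subst (ℚ.∣ s k ℚ.* t k ∣ ℚ.<_) Kδ≡ε (*-bound {p = s k} {q = t k} 0<K p q))
       bounded (nt δ 0<δ)

null⇒nonneg : ∀ {s} → Null s → AsymptoticallyNonneg s
null⇒nonneg {s} ns ε 0<ε = let N , p = ns ε 0<ε in N , λ k k≥ → positive (p k k≥)
  where
  positive : ∀ {r} → ℚ.∣ r ∣ ℚ.< ε → 0ℚ ℚ.< r ℚ.+ ε
  positive {r} r<ε with ℚ.∣p∣≡p∨∣p∣≡-p r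
  ... | inj₁ ∣r∣≡r  = ℚ.+-mono-≤-< (ℚ.∣p∣≡p⇒0≤p ∣r∣≡r) 0<ε
  ... | inj₂ ∣r∣≡-r = subst (ℚ._< r ℚ.+ ε) (ℚ.+-inverseʳ r)
    (ℚ.+-monoʳ-< r (subst (ℚ._< ε) ∣r∣≡-r r<ε))

nonneg-+ : ∀ s t → AsymptoticallyNonneg s → AsymptoticallyNonneg t →
  AsymptoticallyNonneg (λ k → s k ℚ.+ t k)
nonneg-+ s t ns nt ε 0<ε = eventually₂
  (λ k p q → subst (0ℚ ℚ.<_)
    (trans (regroup (s k) (t k) (½ ℚ.* ε)) (cong (s k ℚ.+ t k ℚ.+_) (half+half ε)))
    (ℚ.+-mono-< p q))
  (ns (½ ℚ.* ε) (half-pos 0<ε)) (nt (½ ℚ.* ε) (half-pos 0<ε))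
  where
  regroup : ∀ p q r → (p ℚ.+ r) ℚ.+ (q ℚ.+ r) ≡ p ℚ.+ q ℚ.+ (r ℚ.+ r)
  regroup = solve 3 (λ p q r → (p :+ r) :+ (q :+ r) := p :+ q :+ (r :+ r)) refl

nonneg-sum : ∀ {s : Fin m → ℕ → ℚ} → (∀ j → AsymptoticallyNonneg (s j)) →
  AsymptoticallyNonneg (λ k → sumℚ λ j → s j k)
nonneg-sum {zero}  ns = null⇒nonneg null-0
nonneg-sum {suc m} {s} ns =
  nonneg-+ (s zero) (λ k → sumℚ λ j → s (suc j) k) (ns zero) (nonneg-sum (ns ∘ suc))

nonneg-* : ∀ {s q} → 0ℚ ℚ.≤ q → AsymptoticallyNonneg s → AsymptoticallyNonneg (λ k → s k ℚ.* q)
nonneg-* {s} {q} 0≤q ns ε 0<ε =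
  -- The error is divided by `1 + q`, as `q` itself may be 0.
  let δ , 0<δ , Kδ≡ε = scale (ℚ.+-mono-<-≤ (ℚ.positive⁻¹ 1ℚ) 0≤q) 0<ε
      N , p = ns δ 0<δ
      qδ<ε = subst (q ℚ.* δ ℚ.<_) Kδ≡ε (ℚ.*-monoˡ-<-pos δ {{ℚ.positive 0<δ}} q<1+q)
  in N , λ k k≥ → ℚ.≤-<-trans
       (subst (0ℚ ℚ.≤_) (ℚ.*-distribʳ-+ q (s k) δ) (0≤* (ℚ.<⇒≤ (p k k≥)) 0≤q))
       (ℚ.+-monoʳ-< (s k ℚ.* q) (subst (ℚ._< ε) (ℚ.*-comm q δ) qδ<ε))
  where
  q<1+q : q ℚ.< 1ℚ ℚ.+ q
  q<1+q = subst (ℚ._< 1ℚ ℚ.+ q) (ℚ.+-identityˡ q) (ℚ.+-monoˡ-< q (ℚ.positive⁻¹ 1ℚ))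

nonneg-constant : ∀ {q} → AsymptoticallyNonneg (λ _ → q) → 0ℚ ℚ.≤ q
nonneg-constant {q} ns = ℚ.≮⇒≥ λ q<0 →
  let N , p = ns (ℚ.- q) (ℚ.neg-antimono-< q<0)
  in ℚ.<-irrefl (sym (ℚ.+-inverseʳ q)) (p N ℕ.≤-refl)

nonneg-respects : ∀ {s t} → (∀ k → s k ≡ t k) → AsymptoticallyNonneg s → AsymptoticallyNonneg t
nonneg-respects s≗t ns ε 0<ε =
  let N , p = ns ε 0<ε in N , λ k k≥ → subst (λ r → 0ℚ ℚ.< r ℚ.+ ε) (s≗t k) (p k k≥)

-- At a fixed stage of their Cauchy sequences, real weights need not sum to 1. The last term records
-- this defect, which vanishes in the limit.
affine-sum : ∀ β (α : Vector ℚ d) (w : Vector ℚ m) (q : Fin m → Vector ℚ d) →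
  affine β α (λ a → sumℚ λ j → w j ℚ.* q j a) ≡
  (sumℚ λ j → w j ℚ.* affine β α (q j)) ℚ.+ β ℚ.* (1ℚ ℚ.- sumℚ w)
affine-sum β α w q = sym (begin
  (sumℚ λ j → w j ℚ.* affine β α (q j)) ℚ.+ β ℚ.* (1ℚ ℚ.- sumℚ w)
    ≡⟨ cong (ℚ._+ β ℚ.* (1ℚ ℚ.- sumℚ w)) (trans
         (Σℚ.sum-cong-≗ λ j → ℚ.*-distribˡ-+ (w j) β (dot j))
         (Σℚ.∑-distrib-+ (λ j → w j ℚ.* β) (λ j → w j ℚ.* dot j))) ⟩
  (sumℚ (λ j → w j ℚ.* β) ℚ.+ sumℚ (λ j → w j ℚ.* dot j)) ℚ.+ β ℚ.* (1ℚ ℚ.- sumℚ w)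
    ≡⟨ cong₂ (λ p q → (p ℚ.+ q) ℚ.+ β ℚ.* (1ℚ ℚ.- sumℚ w)) (sym (Σℚ.*-distribʳ-sum β w)) swap ⟩
  (sumℚ w ℚ.* β ℚ.+ sumℚ (λ a → α a ℚ.* sumℚ λ j → w j ℚ.* q j a)) ℚ.+ β ℚ.* (1ℚ ℚ.- sumℚ w)
    ≡⟨ regroup (sumℚ w) β _ ⟩
  affine β α (λ a → sumℚ λ j → w j ℚ.* q j a) ∎)
  where
  open ≡-Reasoning
  dot : Vector ℚ _
  dot j = sumℚ λ a → α a ℚ.* q j a
  regroup : ∀ s β t → (s ℚ.* β ℚ.+ t) ℚ.+ β ℚ.* (1ℚ ℚ.- s) ≡ β ℚ.+ t
  regroup = solve 3 (λ s β t → (s :* β :+ t) :+ β :* (con 1ℚ :- s) := β :+ t) refl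
  exchange : ∀ w a q → w ℚ.* (a ℚ.* q) ≡ a ℚ.* (w ℚ.* q)
  exchange = solve 3 (λ w a q → w :* (a :* q) := a :* (w :* q)) refl
  swap : sumℚ (λ j → w j ℚ.* dot j) ≡ sumℚ (λ a → α a ℚ.* sumℚ λ j → w j ℚ.* q j a)
  swap = begin
    sumℚ (λ j → w j ℚ.* dot j)
      ≡⟨ Σℚ.sum-cong-≗ (λ j → trans (Σℚ.*-distribˡ-sum (w j) (λ a → α a ℚ.* q j a))
           (Σℚ.sum-cong-≗ λ a → exchange (w j) (α a) (q j a))) ⟩
    sumℚ (λ j → sumℚ λ a → α a ℚ.* (w j ℚ.* q j a))
      ≡⟨ Σℚ.∑-comm (λ j a → α a ℚ.* (w j ℚ.* q j a)) ⟩
    sumℚ (λ a → sumℚ λ j → α a ℚ.* (w j ℚ.* q j a))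
      ≡⟨ Σℚ.sum-cong-≗ (λ a → Σℚ.*-distribˡ-sum (α a) λ j → w j ℚ.* q j a) ⟨
    sumℚ (λ a → α a ℚ.* sumℚ λ j → w j ℚ.* q j a) ∎

affine-difference : ∀ β (α x y : Vector ℚ d) →
  affine β α x ≡ affine β α y ℚ.+ sumℚ λ a → α a ℚ.* (x a ℚ.- y a)
affine-difference β α x y = trans (cong (β ℚ.+_) (trans
    (Σℚ.sum-cong-≗ λ a → split (α a) (x a) (y a))
    (Σℚ.∑-distrib-+ (λ a → α a ℚ.* y a) (λ a → α a ℚ.* (x a ℚ.- y a)))))
  (sym (ℚ.+-assoc β _ _))
  where
  split : ∀ α x y → α ℚ.* x ≡ α ℚ.* y ℚ.+ α ℚ.* (x ℚ.- y)
  split = solve 3 (λ α x y → α :* x := α :* y :+ α :* (x :- y)) refl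

-- At stage `k` of all sequences, `affine β α x` is a combination of nonnegative values with
-- asymptotically nonnegative weights, plus errors tending to 0. As it does not depend on `k`, it is
-- nonnegative.
convexHull-nonneg : ∀ {S : Point d → Set} β α {x} →
  (∀ {y} → S y → ∃[ q ] (y ≈ᴾ (constant ∘ q) × 0ℚ ℚ.≤ affine β α q)) →
  ConvexHull S (constant ∘ x) → 0ℚ ℚ.≤ affine β α x
convexHull-nonneg β α {x} rational (m , p , w , Sp , 0≤w , Σw≈1 , x≈) =
  nonneg-constant (nonneg-respects (λ k → sym (expand k))
    (nonneg-+ main rest
      (nonneg-+ main₀ main₁
        (nonneg-sum λ j → nonneg-* {s = λ k → W k j} (0≤q j) λ ε 0<ε → 0≤w j ε 0<ε)
        (null⇒nonneg (null-* (λ _ → β) (λ k → 1ℚ ℚ.- sumℚ (W k)) (const-cauchy β) total)))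
      (null⇒nonneg (null-sum λ a →
        null-* (λ _ → α a) (λ k → x a ℚ.- y k a) (const-cauchy (α a)) (coordinate a)))))
  where
  q = λ j → proj₁ (rational (Sp j))
  p≈q = λ j → proj₁ (proj₂ (rational (Sp j)))
  0≤q = λ j → proj₂ (proj₂ (rational (Sp j)))
  W : ℕ → Vector ℚ m
  W k j = seq (w j) k
  y : ℕ → Vector ℚ _
  y k a = sumℚ λ j → W k j ℚ.* q j a
  -- `main₁` is the error from the sum of the weights and `rest` the error from the coordinates of
  -- `x`.
  main₀ main₁ main rest : ℕ → ℚ
  main₀ k = sumℚ λ j → W k j ℚ.* affine β α (q j)
  main₁ k = β ℚ.* (1ℚ ℚ.- sumℚ (W k))
  main  k = main₀ k ℚ.+ main₁ k
  rest  k = sumℚ λ a → α a ℚ.* (x a ℚ.- y k a)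
  expand : ∀ k → affine β α x ≡ main k ℚ.+ rest k
  expand k = trans (affine-difference β α x (y k)) (cong (ℚ._+ rest k) (affine-sum β α (W k) q))
  neg-sub : ∀ r s → ℚ.- (r ℚ.- s) ≡ s ℚ.- r
  neg-sub = solve 2 (λ r s → :- (r :- s) := s :- r) refl
  total : Null (λ k → 1ℚ ℚ.- sumℚ (W k))
  total ε 0<ε = let N , b = Σw≈1 ε 0<ε in N , λ k k≥ → subst (ℚ._< ε)
    (trans (sym (ℚ.∣-p∣≡∣p∣ (seq (sumᴿ w) k ℚ.- 1ℚ))) (cong ℚ.∣_∣
      (trans (neg-sub (seq (sumᴿ w) k) 1ℚ) (cong (λ r → 1ℚ ℚ.- r) (seq-sum w k)))))
    (b k k≥)
  errors : ∀ {m} (W P Q : Vector ℚ m) x →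
    (x ℚ.- sumℚ λ j → W j ℚ.* P j) ℚ.+ (sumℚ λ j → W j ℚ.* (P j ℚ.- Q j)) ≡
    x ℚ.- sumℚ λ j → W j ℚ.* Q j
  errors W P Q x = trans (cong ((x ℚ.- sumℚ λ j → W j ℚ.* P j) ℚ.+_)
      (trans (Σℚ.sum-cong-≗ λ j → expand′ (W j) (P j) (Q j))
        (Σℚ.∑-distrib-+ (λ j → W j ℚ.* P j) (λ j → ℚ.- 1ℚ ℚ.* (W j ℚ.* Q j)))))
    (trans (cong (λ r → (x ℚ.- sumℚ λ j → W j ℚ.* P j) ℚ.+ ((sumℚ λ j → W j ℚ.* P j) ℚ.+ r))
        (sym (Σℚ.*-distribˡ-sum (ℚ.- 1ℚ) λ j → W j ℚ.* Q j)))
      (cancel x _ _))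
    where
    expand′ : ∀ w p q → w ℚ.* (p ℚ.- q) ≡ w ℚ.* p ℚ.+ ℚ.- 1ℚ ℚ.* (w ℚ.* q)
    expand′ = solve 3 (λ w p q → w :* (p :- q) := w :* p :+ con (ℚ.- 1ℚ) :* (w :* q)) refl
    cancel : ∀ x s t → (x ℚ.- s) ℚ.+ (s ℚ.+ ℚ.- 1ℚ ℚ.* t) ≡ x ℚ.- t
    cancel = solve 3 (λ x s t → (x :- s) :+ (s :+ con (ℚ.- 1ℚ) :* t) := x :- t) refl
  -- The first error compares `x` with the real combination of the points `p j`; the second comes
  -- from replacing each `p j` by its rational representative `q j`.
  real-error rational-error : Fin _ → ℕ → ℚ
  real-error a k = x a ℚ.- sumℚ λ j → W k j ℚ.* seq (p j a) k
  rational-error a k = sumℚ λ j → W k j ℚ.* (seq (p j a) k ℚ.- q j a)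
  coordinate : ∀ a → Null (λ k → x a ℚ.- y k a)
  coordinate a = null-respects (λ k → errors (W k) (λ j → seq (p j a) k) (λ j → q j a) (x a))
    (null-+ (real-error a) (rational-error a)
      (null-respects (λ k → cong (λ r → x a ℚ.- r) (seq-sum (λ j → w j *ᴿ p j a) k)) (x≈ a))
      (null-sum λ j → null-* (λ k → W k j) (λ k → seq (p j a) k ℚ.- q j a) (cauchy (w j)) (p≈q j a)))

-- Greedy bases

∣p∩q∣+∣p─q∣≡∣p∣ : ∀ (p q : Subset n) → ∣ p ∩ q ∣ ℕ.+ ∣ p ─ q ∣ ≡ ∣ p ∣
∣p∩q∣+∣p─q∣≡∣p∣ []            []            = refl
∣p∩q∣+∣p─q∣≡∣p∣ (outside ∷ p) (outside ∷ q) = ∣p∩q∣+∣p─q∣≡∣p∣ p q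
∣p∩q∣+∣p─q∣≡∣p∣ (outside ∷ p) (inside  ∷ q) = ∣p∩q∣+∣p─q∣≡∣p∣ p q
∣p∩q∣+∣p─q∣≡∣p∣ (inside  ∷ p) (outside ∷ q) = trans (ℕ.+-suc _ _) (cong suc (∣p∩q∣+∣p─q∣≡∣p∣ p q))
∣p∩q∣+∣p─q∣≡∣p∣ (inside  ∷ p) (inside  ∷ q) = cong suc (∣p∩q∣+∣p─q∣≡∣p∣ p q)

∣p∪q∣≤∣p∣+∣q∣ : ∀ (p q : Subset n) → ∣ p ∪ q ∣ ℕ.≤ ∣ p ∣ ℕ.+ ∣ q ∣
∣p∪q∣≤∣p∣+∣q∣ []            []            = ℕ.z≤n
∣p∪q∣≤∣p∣+∣q∣ (outside ∷ p) (outside ∷ q) = ∣p∪q∣≤∣p∣+∣q∣ p q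
∣p∪q∣≤∣p∣+∣q∣ (outside ∷ p) (inside  ∷ q) =
  ℕ.≤-trans (ℕ.s≤s (∣p∪q∣≤∣p∣+∣q∣ p q)) (ℕ.≤-reflexive (sym (ℕ.+-suc _ _)))
∣p∪q∣≤∣p∣+∣q∣ (inside  ∷ p) (outside ∷ q) = ℕ.s≤s (∣p∪q∣≤∣p∣+∣q∣ p q)
∣p∪q∣≤∣p∣+∣q∣ (inside  ∷ p) (inside  ∷ q) =
  ℕ.s≤s (ℕ.≤-trans (∣p∪q∣≤∣p∣+∣q∣ p q) (ℕ.+-monoʳ-≤ ∣ p ∣ (ℕ.n≤1+n ∣ q ∣)))

∈-vectorsOver : ∀ {a} {A : Set a} {xs : List A} → (∀ x → x ∈ xs) → ∀ (v : Vec A k) → v ∈ vectorsOver xs k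
∈-vectorsOver all∈ []      = here refl
∈-vectorsOver all∈ (x ∷ v) = ∈-cartesianProductWith⁺ _∷_ (all∈ x) (∈-vectorsOver all∈ v)

∈-subsets : ∀ (X : Subset n) → X ∈ subsets n
∈-subsets = ∈-vectorsOver λ { outside → here refl ; inside → there (here refl) }

-- This is `digits` applied to the sizes `∣ B ─ A ∣`, so that costs can be compared entry by entry
-- with the coranks in `minimal-cost`.
cost : ℕ → Vec (Subset n) k → Subset n → ℕ
cost N []       B = 0
cost N (A ∷ As) B = ∣ B ─ A ∣ ℕ.+ N ℕ.* cost N As B

-- Least significant digit first.
digits : ℕ → Vec ℕ k → ℕ
digits N []       = 0
digits N (e ∷ es) = e ℕ.+ N ℕ.* digits N es

digits-injective : ∀ N .{{_ : ℕ.NonZero N}} {ds es : Vec ℕ k} →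
  VecAll.All (ℕ._< N) ds → VecAll.All (ℕ._< N) es →
  digits N ds ≡ digits N es → ds ≡ es
digits-injective N []           []           eq = refl
digits-injective N {d ∷ ds} {e ∷ es} (d<N ∷ ds<N) (e<N ∷ es<N) eq = cong₂ _∷_ d≡e
  (digits-injective N ds<N es<N (ℕ.*-cancelˡ-≡ _ _ N (ℕ.+-cancelˡ-≡ e _ _
    (trans (cong (ℕ._+ N ℕ.* digits N ds) (sym d≡e)) eq))))
  where
  residue : ∀ {r} q → r ℕ.< N → (r ℕ.+ N ℕ.* q) ℕ.% N ≡ r
  residue {r} q r<N = trans (cong (λ z → (r ℕ.+ z) ℕ.% N) (ℕ.*-comm N q))
    (trans (ℕ.[m+kn]%n≡m%n r q N) (ℕ.m<n⇒m%n≡m r<N))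
  d≡e = trans (sym (residue (digits N ds) d<N)) (trans (cong (ℕ._% N) eq) (residue (digits N es) e<N))

module _ (M : Matroid n) where
  open Matroid M

  -- By submodularity, passing from `Y` to `X` lowers the rank by at most `∣ Y ─ X ∣`, which is the
  -- loss in size.
  independent-⊆ : ∀ {X Y} → X ⊆ Y → Independent Y → Independent X
  independent-⊆ {X} {Y} X⊆Y indY = ℕ.≤-antisym (rk-bounded X) (ℕ.+-cancelʳ-≤ ∣ Y ─ X ∣ _ _ (begin
    ∣ X ∣ ℕ.+ ∣ Y ─ X ∣              ≤⟨ ℕ.+-monoˡ-≤ ∣ Y ─ X ∣ (Subset.p⊆q⇒∣p∣≤∣q∣ X⊆Y∩X) ⟩
    ∣ Y ∩ X ∣ ℕ.+ ∣ Y ─ X ∣          ≡⟨ ∣p∩q∣+∣p─q∣≡∣p∣ Y X ⟩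
    ∣ Y ∣                            ≡⟨ indY ⟨
    rk Y                             ≤⟨ rk-monotone Y⊆ ⟩
    rk (X ∪ (Y ─ X))                 ≤⟨ ℕ.m≤m+n _ _ ⟩
    rk (X ∪ (Y ─ X)) ℕ.+ rk (X ∩ (Y ─ X)) ≤⟨ rk-submodular X (Y ─ X) ⟩
    rk X ℕ.+ rk (Y ─ X)              ≤⟨ ℕ.+-monoʳ-≤ (rk X) (rk-bounded (Y ─ X)) ⟩
    rk X ℕ.+ ∣ Y ─ X ∣               ∎))
    where
    open ℕ.≤-Reasoning
    X⊆Y∩X : X ⊆ Y ∩ X
    X⊆Y∩X x∈X = Subset.x∈p∩q⁺ (X⊆Y x∈X , x∈X)
    Y⊆ : Y ⊆ X ∪ (Y ─ X)
    Y⊆ {y} y∈Y with y ∈? X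
    ... | yes y∈X = Subset.x∈p∪q⁺ (inj₁ y∈X)
    ... | no  y∉X = Subset.x∈p∪q⁺ (inj₂ (Subset.x∈p∧x∉q⇒x∈p─q y∈Y y∉X))

  -- S holds elements already examined; they lie in the span of I.
  extend-along : ∀ {A} (es : List (Fin n)) I S → I ⊆ A → Independent I → rk (I ∪ S) ℕ.≤ rk I →
    (∀ {a} → a Subset.∈ A → a Subset.∈ S ⊎ a ∈ es) →
    ∃[ J ] (I ⊆ J × J ⊆ A × Independent J × rk A ℕ.≤ rk J)
  extend-along {A} [] I S I⊆A indI closed covers =
    I , id , I⊆A , indI , ℕ.≤-trans (rk-monotone λ a∈A → Subset.q⊆p∪q I S (inS (covers a∈A))) closed
    where
    inS : ∀ {a} → a Subset.∈ S ⊎ a ∈ [] → a Subset.∈ S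
    inS (inj₁ a∈S) = a∈S
  extend-along {A} (e ∷ es) I S I⊆A indI closed covers with e ∈? A
  ... | no e∉A = extend-along es I S I⊆A indI closed λ a∈A → case covers a∈A of λ
    { (inj₁ a∈S) → inj₁ a∈S ; (inj₂ (here refl)) → contradiction a∈A e∉A ; (inj₂ (there a∈es)) → inj₂ a∈es }
  ... | yes e∈A = step (rk (I ∪ ⁅ e ⁆) ℕ.≤? rk I)
    where
    S′ = S ∪ ⁅ e ⁆
    covers′ : ∀ {a} → a Subset.∈ A → a Subset.∈ S′ ⊎ a ∈ es
    covers′ a∈A with covers a∈A
    ... | inj₁ a∈S           = inj₁ (Subset.p⊆p∪q ⁅ e ⁆ a∈S)
    ... | inj₂ (here refl)   = inj₁ (Subset.q⊆p∪q S ⁅ e ⁆ (Subset.x∈⁅x⁆ e))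
    ... | inj₂ (there a∈es)  = inj₂ a∈es
    union⊆ : I ∪ S′ ⊆ (I ∪ S) ∪ (I ∪ ⁅ e ⁆)
    union⊆ x∈ with Subset.x∈p∪q⁻ I S′ x∈
    ... | inj₁ x∈I = Subset.p⊆p∪q (I ∪ ⁅ e ⁆) (Subset.p⊆p∪q S x∈I)
    ... | inj₂ x∈S′ with Subset.x∈p∪q⁻ S ⁅ e ⁆ x∈S′
    ...   | inj₁ x∈S = Subset.p⊆p∪q (I ∪ ⁅ e ⁆) (Subset.q⊆p∪q I S x∈S)
    ...   | inj₂ x∈e = Subset.q⊆p∪q (I ∪ S) (I ∪ ⁅ e ⁆) (Subset.q⊆p∪q I ⁅ e ⁆ x∈e)
    -- Submodularity is applied to `I ∪ S` and `I ∪ ⁅ e ⁆`, whose intersection contains `I`; by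
    -- `closed`, adding `S` to `I` does not raise the rank.
    spanned : rk (I ∪ S′) ℕ.≤ rk (I ∪ ⁅ e ⁆)
    spanned = ℕ.+-cancelʳ-≤ (rk I) _ _ (begin
      rk (I ∪ S′) ℕ.+ rk I
        ≤⟨ ℕ.+-mono-≤ (rk-monotone union⊆)
             (rk-monotone λ x∈I → Subset.x∈p∩q⁺ (Subset.p⊆p∪q S x∈I , Subset.p⊆p∪q ⁅ e ⁆ x∈I)) ⟩
      rk ((I ∪ S) ∪ (I ∪ ⁅ e ⁆)) ℕ.+ rk ((I ∪ S) ∩ (I ∪ ⁅ e ⁆))
        ≤⟨ rk-submodular (I ∪ S) (I ∪ ⁅ e ⁆) ⟩
      rk (I ∪ S) ℕ.+ rk (I ∪ ⁅ e ⁆)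
        ≤⟨ ℕ.+-monoˡ-≤ _ closed ⟩
      rk I ℕ.+ rk (I ∪ ⁅ e ⁆)
        ≡⟨ ℕ.+-comm (rk I) _ ⟩
      rk (I ∪ ⁅ e ⁆) ℕ.+ rk I ∎)
      where open ℕ.≤-Reasoning
    absorbed : (I ∪ ⁅ e ⁆) ∪ S′ ⊆ I ∪ S′
    absorbed x∈ with Subset.x∈p∪q⁻ (I ∪ ⁅ e ⁆) S′ x∈
    ... | inj₂ x∈S′ = Subset.q⊆p∪q I S′ x∈S′
    ... | inj₁ x∈I∪e with Subset.x∈p∪q⁻ I ⁅ e ⁆ x∈I∪e
    ...   | inj₁ x∈I = Subset.p⊆p∪q S′ x∈I
    ...   | inj₂ x∈e = Subset.q⊆p∪q I S′ (Subset.q⊆p∪q S ⁅ e ⁆ x∈e)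
    I∪e⊆A : I ∪ ⁅ e ⁆ ⊆ A
    I∪e⊆A x∈ with Subset.x∈p∪q⁻ I ⁅ e ⁆ x∈
    ... | inj₁ x∈I = I⊆A x∈I
    ... | inj₂ x∈e = subst (Subset._∈ A) (sym (Subset.x∈⁅y⁆⇒x≡y e x∈e)) e∈A
    -- The rank grows by at least one and the size by at most one.
    independent : ¬ rk (I ∪ ⁅ e ⁆) ℕ.≤ rk I → Independent (I ∪ ⁅ e ⁆)
    independent rk≰ = ℕ.≤-antisym (rk-bounded _) (begin
      ∣ I ∪ ⁅ e ⁆ ∣       ≤⟨ ∣p∪q∣≤∣p∣+∣q∣ I ⁅ e ⁆ ⟩
      ∣ I ∣ ℕ.+ ∣ ⁅ e ⁆ ∣ ≡⟨ cong₂ ℕ._+_ (sym indI) (Subset.∣⁅x⁆∣≡1 e) ⟩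
      rk I ℕ.+ 1          ≡⟨ ℕ.+-comm (rk I) 1 ⟩
      suc (rk I)          ≤⟨ ℕ.≰⇒> rk≰ ⟩
      rk (I ∪ ⁅ e ⁆)      ∎)
      where open ℕ.≤-Reasoning
    step : Dec (rk (I ∪ ⁅ e ⁆) ℕ.≤ rk I) → ∃[ J ] (I ⊆ J × J ⊆ A × Independent J × rk A ℕ.≤ rk J)
    -- In either case `e` counts as examined; it joins `I` only if this raises the rank.
    step (yes rk≤) = extend-along es I S′ I⊆A indI (ℕ.≤-trans spanned rk≤) covers′
    step (no  rk≰) =
      let J , I∪e⊆J , J⊆A , indJ , spans = extend-along es (I ∪ ⁅ e ⁆) S′ I∪e⊆A (independent rk≰)
            (ℕ.≤-trans (rk-monotone absorbed) spanned) covers′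
      in J , (λ x∈I → I∪e⊆J (Subset.p⊆p∪q ⁅ e ⁆ x∈I)) , J⊆A , indJ , spans

  extend : ∀ {I A} → I ⊆ A → Independent I →
    ∃[ J ] (I ⊆ J × J ⊆ A × Independent J × rk A ℕ.≤ rk J)
  -- Taking `I` itself as the examined set makes the initial span condition trivial.
  extend {I} I⊆A indI = extend-along (List.allFin n) I I I⊆A indI
    (rk-monotone λ x∈ → Sum.reduce (Subset.x∈p∪q⁻ I I x∈)) λ {a} _ → inj₂ (∈-allFin a)

  basis⇒spanning : ∀ {B} → IsBasis B → rk B ≡ rank
  basis⇒spanning {B} (indB , maximal) with extend {B} {⊤} Subset.⊆⊤ indB
  ... | J , B⊆J , _ , indJ , spans with maximal indJ B⊆J
  ... | refl = ℕ.≤-antisym (rk-monotone Subset.⊆⊤) spans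

  spanning⇒basis : ∀ {B} → Independent B → rank ℕ.≤ rk B → IsBasis B
  spanning⇒basis {B} indB spans = indB , λ {X} indX B⊆X → Subset.⊆-antisym (X⊆B indX B⊆X) B⊆X
    where
    X⊆B : ∀ {X} → Independent X → B ⊆ X → X ⊆ B
    X⊆B {X} indX B⊆X {x} x∈X with x ∈? B
    ... | yes x∈B = x∈B
    ... | no  x∉B = contradiction (Subset.p⊂q⇒∣p∣<∣q∣ (B⊆X , x , x∈X , x∉B)) (ℕ.≤⇒≯
      (subst₂ ℕ._≤_ indX indB (ℕ.≤-trans (rk-monotone Subset.⊆⊤) spans)))

  -- `IsBasis` quantifies over all independent sets. Independence together with full rank is
  -- equivalent by the two preceding lemmas, and it is decided by comparing numbers.
  isBasis? : ∀ B → Dec (Independent B × rank ℕ.≤ rk B)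
  isBasis? B = (rk B ℕ.≟ ∣ B ∣) ×-dec (rank ℕ.≤? rk B)

  bases : List (Subset n)
  bases = List.filter isBasis? (subsets n)

  ∈-bases⁻ : ∀ {B} → B ∈ bases → IsBasis B
  ∈-bases⁻ B∈ = let indB , spans = proj₂ (∈-filter⁻ isBasis? {xs = subsets n} B∈) in spanning⇒basis indB spans

  ∈-bases⁺ : ∀ {B} → IsBasis B → B ∈ bases
  ∈-bases⁺ {B} basis@(indB , _) =
    ∈-filter⁺ isBasis? (∈-subsets B) (indB , ℕ.≤-reflexive (sym (basis⇒spanning basis)))

  corank : Subset n → ℕ
  corank A = rank ℕ.∸ rk A

  corank≤n : ∀ A → corank A ℕ.≤ n
  corank≤n A = ℕ.≤-trans (ℕ.m∸n≤m rank (rk A)) (ℕ.≤-trans (rk-bounded ⊤) (Subset.∣p∣≤n ⊤))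

  basis-rank : ∀ {B} → IsBasis B → ∀ A → rank ≡ ∣ B ∩ A ∣ ℕ.+ ∣ B ─ A ∣
  basis-rank {B} basis A = trans (sym (basis⇒spanning basis))
    (trans (proj₁ basis) (sym (∣p∩q∣+∣p─q∣≡∣p∣ B A)))

  -- `B ∩ A` is an independent subset of `A`, hence has at most `rk A` elements.
  corank≤∣B─A∣ : ∀ {B} → IsBasis B → ∀ A → corank A ℕ.≤ ∣ B ─ A ∣
  corank≤∣B─A∣ {B} basis A = ℕ.m≤n+o⇒m∸n≤o rank (rk A) (begin
    rank                        ≡⟨ basis-rank basis A ⟩
    ∣ B ∩ A ∣ ℕ.+ ∣ B ─ A ∣     ≡⟨ cong (ℕ._+ _) (independent-⊆ (Subset.p∩q⊆p B A) (proj₁ basis)) ⟨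
    rk (B ∩ A) ℕ.+ ∣ B ─ A ∣    ≤⟨ ℕ.+-monoˡ-≤ _ (rk-monotone (Subset.p∩q⊆q B A)) ⟩
    rk A ℕ.+ ∣ B ─ A ∣          ∎)
    where open ℕ.≤-Reasoning

  -- `J` lies in `B ∩ A` and has at least `rk A` elements, so few elements of `B` remain outside
  -- `A`.
  ∣B─A∣≤corank : ∀ {B} → IsBasis B → ∀ {A J} → J ⊆ A → J ⊆ B → Independent J → rk A ℕ.≤ rk J →
    ∣ B ─ A ∣ ℕ.≤ corank A
  ∣B─A∣≤corank {B} basis {A} {J} J⊆A J⊆B indJ spans = ℕ.m+n≤o⇒m≤o∸n ∣ B ─ A ∣ (begin
    ∣ B ─ A ∣ ℕ.+ rk A          ≤⟨ ℕ.+-monoʳ-≤ ∣ B ─ A ∣ spans ⟩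
    ∣ B ─ A ∣ ℕ.+ rk J          ≡⟨ cong (∣ B ─ A ∣ ℕ.+_) indJ ⟩
    ∣ B ─ A ∣ ℕ.+ ∣ J ∣         ≤⟨ ℕ.+-monoʳ-≤ ∣ B ─ A ∣ (Subset.p⊆q⇒∣p∣≤∣q∣ λ x∈J →
                                     Subset.x∈p∩q⁺ (J⊆B x∈J , J⊆A x∈J)) ⟩
    ∣ B ─ A ∣ ℕ.+ ∣ B ∩ A ∣     ≡⟨ ℕ.+-comm ∣ B ─ A ∣ _ ⟩
    ∣ B ∩ A ∣ ℕ.+ ∣ B ─ A ∣     ≡⟨ basis-rank basis A ⟨
    rank                        ∎)
    where open ℕ.≤-Reasoning

  minimal-cost : ℕ → Vec (Subset n) k → ℕ
  minimal-cost N As = digits N (Vec.map corank As)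

  minimal-cost≤cost : ∀ N (As : Vec (Subset n) k) {B} → IsBasis B → minimal-cost N As ℕ.≤ cost N As B
  minimal-cost≤cost N []       basis = ℕ.z≤n
  minimal-cost≤cost N (A ∷ As) basis =
    ℕ.+-mono-≤ (corank≤∣B─A∣ basis A) (ℕ.*-monoʳ-≤ N (minimal-cost≤cost N As basis))

  -- Greedy choice along the chain: `I` is enlarged inside `A` to an independent `J` spanning `A`,
  -- and `J` is the start for the next set. The final basis contains all these sets, so it attains
  -- every bound `corank A` simultaneously.
  extend-chain : ∀ N {A} {As : Vec (Subset n) k} → Linked _⊆_ (A ∷ As) → ∀ {I} → I ⊆ A → Independent I →
    ∃[ B ] (I ⊆ B × IsBasis B × cost N (A ∷ As) B ℕ.≤ minimal-cost N (A ∷ As))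
  extend-chain N {A} {As} linked I⊆A indI with extend I⊆A indI
  ... | J , I⊆J , J⊆A , indJ , spans with rest As linked
    where
    rest : ∀ {k} (As : Vec (Subset n) k) → Linked _⊆_ (A ∷ As) →
      ∃[ B ] (J ⊆ B × IsBasis B × cost N As B ℕ.≤ minimal-cost N As)
    rest [] [-] with extend {J} {⊤} Subset.⊆⊤ indJ
    ... | B , J⊆B , _ , indB , spansB = B , J⊆B , spanning⇒basis indB spansB , ℕ.z≤n
    rest (A′ ∷ As′) (A⊆A′ ∷ linked′) = extend-chain N linked′ (λ x∈J → A⊆A′ (J⊆A x∈J)) indJ
  ...   | B , J⊆B , basis , cost≤ = B , (λ x∈I → J⊆B (I⊆J x∈I)) , basis
    , ℕ.+-mono-≤ (∣B─A∣≤corank basis J⊆A J⊆B indJ spans) (ℕ.*-monoʳ-≤ N cost≤)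

  minimal-cost-attained : ∀ N {As : Vec (Subset n) k} → Linked _⊆_ As →
    ∃[ B ] (IsBasis B × cost N As B ≡ minimal-cost N As)
  minimal-cost-attained N {As} linked = let B , basis , cost≤ = chain linked in
    B , basis , ℕ.≤-antisym cost≤ (minimal-cost≤cost N As basis)
    where
    independent-⊥ : Independent ⊥
    independent-⊥ = ℕ.≤-antisym (rk-bounded ⊥) (subst (ℕ._≤ rk ⊥) (sym (Subset.∣⊥∣≡0 n)) ℕ.z≤n)
    chain : ∀ {k} {As : Vec (Subset n) k} → Linked _⊆_ As →
      ∃[ B ] (IsBasis B × cost N As B ℕ.≤ minimal-cost N As)
    chain {As = []}     _      with extend {⊥} {⊤} Subset.⊆⊤ independent-⊥
    ... | B , _ , _ , indB , spans = B , spanning⇒basis indB spans , ℕ.z≤n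
    chain {As = A ∷ As} linked = let B , _ , found = extend-chain N linked Subset.⊥⊆ independent-⊥ in B , found

-- Lifted base polytopes

module _ (M : Matroid n) where

  -- The value of the functional comes first because `slice` fixes the first coordinate.
  lifted : Vector ℚ n → List (Vector ℚ (suc n))
  lifted ω = List.map (λ B → (sumℚ λ a → ω a ℚ.* indicator B a) Fun.∷ indicator B) (bases M)

  -- A hull certificate is projected to a rational convex combination of bases. A separating
  -- functional is pulled back along `x ↦ (ω x , x)`, and `convexHull-nonneg` then excludes real
  -- combinations.
  hullIndicator-lifted : ∀ ω x → let t = sumℚ λ a → ω a ℚ.* x a in
    (hullIndicator (lifted ω) (t Fun.∷ x) ≡ 1ℤ × BasePolytope M (constant ∘ x)) ⊎
    (hullIndicator (lifted ω) (t Fun.∷ x) ≡ 0ℤ × ¬ BasePolytope M (constant ∘ x))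
  hullIndicator-lifted ω x = Sum.map
    (map₂ λ hull → rationalHull⇒basePolytope M (List.lookup (bases M)) (λ j → ∈-bases⁻ M (∈-lookup j))
      (hull {λ y → RationalHull (indicator ∘ List.lookup (bases M)) (Fun.tail y)}
        (λ μ 0≤μ μ≤1 Cy Cy′ z≡ →
          rationalHull-convex (indicator ∘ List.lookup (bases M)) μ 0≤μ μ≤1 Cy Cy′ (z≡ ∘ suc))
        generator))
    (map₂ λ sep hull → separated⇒∉ sep hull)
    (hullIndicator-spec (lifted ω) ((sumℚ λ a → ω a ℚ.* x a) Fun.∷ x))
    where
    generator : ∀ {v} → v ∈ lifted ω → RationalHull (indicator ∘ List.lookup (bases M)) (Fun.tail v)
    generator v∈ with ∈-map⁻ _ v∈
    ... | B , B∈ , refl = subst (λ B → RationalHull (indicator ∘ List.lookup (bases M)) (indicator B))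
      (sym (lookup-index B∈)) (generator∈rationalHull (indicator ∘ List.lookup (bases M)) (index B∈))
    combine : ∀ c ω α x → c ℚ.* (ω ℚ.* x) ℚ.+ α ℚ.* x ≡ (c ℚ.* ω ℚ.+ α) ℚ.* x
    combine = solve 4 (λ c ω α x → c :* (ω :* x) :+ α :* x := (c :* ω :+ α) :* x) refl
    -- On the graph of `ω` the coefficient of the added coordinate is absorbed into the others.
    fold : ∀ β (α : Vector ℚ (suc n)) y → affine β α ((sumℚ λ a → ω a ℚ.* y a) Fun.∷ y) ≡
      affine β (λ a → α zero ℚ.* ω a ℚ.+ α (suc a)) y
    fold β α y = cong (β ℚ.+_) (trans
      (cong (ℚ._+ sumℚ λ a → α (suc a) ℚ.* y a) (Σℚ.*-distribˡ-sum (α zero) λ a → ω a ℚ.* y a))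
      (trans (sym (Σℚ.∑-distrib-+ (λ a → α zero ℚ.* (ω a ℚ.* y a)) (λ a → α (suc a) ℚ.* y a)))
        (Σℚ.sum-cong-≗ λ a → combine (α zero) (ω a) (α (suc a)) (y a))))
    separated⇒∉ : Separated (lifted ω) ((sumℚ λ a → ω a ℚ.* x a) Fun.∷ x) →
      ¬ BasePolytope M (constant ∘ x)
    separated⇒∉ (β , α , nonneg , neg) hull = ℚ.<-irrefl refl (ℚ.<-≤-trans neg
      (subst (0ℚ ℚ.≤_) (sym (fold β α x))
        (convexHull-nonneg β (λ a → α zero ℚ.* ω a ℚ.+ α (suc a)) (λ {y} → vertices {y}) hull)))
      where
      vertices : ∀ {y} → ∃[ B ] (Matroid.IsBasis M B × (y ≈ᴾ indicatorVector B)) →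
        ∃[ q ] (y ≈ᴾ (constant ∘ q) × 0ℚ ℚ.≤ affine β (λ a → α zero ℚ.* ω a ℚ.+ α (suc a)) q)
      vertices {y} (B , basis , y≈) = indicator B
        , (λ a ε 0<ε → let N , b = y≈ a ε 0<ε in N , λ k k≥ →
            subst (λ r → ℚ.∣ seq (y a) k ℚ.- r ∣ ℚ.< ε) (seq-indicatorVector B a k) (b k k≥))
        , subst (0ℚ ℚ.≤_) (fold β α (indicator B)) (nonneg (∈-map⁺ _ (∈-bases⁺ M basis)))

  -- The graph of `ω` is convex and contains every generator.
  hullIndicator-lifted-≢ : ∀ ω t x → t ≢ (sumℚ λ a → ω a ℚ.* x a) →
    hullIndicator (lifted ω) (t Fun.∷ x) ≡ 0ℤ
  hullIndicator-lifted-≢ ω t x t≢ = Sum.fromInj₂ (λ (_ , hull) → contradiction (graph hull) t≢)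
    (Sum.map₂ proj₁ (hullIndicator-spec (lifted ω) (t Fun.∷ x)))
    where
    distribute : ∀ μ c p q → mix μ (c ℚ.* p) (c ℚ.* q) ≡ c ℚ.* mix μ p q
    distribute = solve 4 (λ μ c p q → μ :* (c :* p) :+ (con 1ℚ :- μ) :* (c :* q) :=
      c :* (μ :* p :+ (con 1ℚ :- μ) :* q)) refl
    graph : (∀ {C} → IsConvex C → (∀ {v} → v ∈ lifted ω → C v) → C (t Fun.∷ x)) →
      t ≡ sumℚ λ a → ω a ℚ.* x a
    graph hull = hull {λ y → y zero ≡ sumℚ λ a → ω a ℚ.* y (suc a)}
      (λ {y} {y′} {z} μ _ _ ey ey′ z≡ → trans (z≡ zero) (trans (cong₂ (mix μ) ey ey′)
        (trans (sym (sum-mix μ (λ a → ω a ℚ.* y (suc a)) (λ a → ω a ℚ.* y′ (suc a))))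
          (Σℚ.sum-cong-≗ λ a → trans (distribute μ (ω a) (y (suc a)) (y′ (suc a)))
            (cong (ω a ℚ.*_) (sym (z≡ (suc a))))))))
      λ v∈ → case ∈-map⁻ _ v∈ of λ { (B , _ , refl) → refl }

-- Integral cost functionals and their minima

ι : ℕ → ℚ
ι k = k ×ℚ 1ℚ

ι-+ : ∀ j k → ι (j ℕ.+ k) ≡ ι j ℚ.+ ι k
ι-+ = ×-homo-+ 1ℚ

ι-* : ∀ j k → ι (j ℕ.* k) ≡ ι j ℚ.* ι k
ι-* = ×1-homo-*

0≤ι : ∀ k → 0ℚ ℚ.≤ ι k
0≤ι zero    = ℚ.≤-refl
0≤ι (suc k) = 0≤+ (ℚ.nonNegative⁻¹ 1ℚ) (0≤ι k)

ι-mono-≤ : ∀ {j k} → j ℕ.≤ k → ι j ℚ.≤ ι k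
ι-mono-≤ {k = k} ℕ.z≤n = 0≤ι k
ι-mono-≤ (ℕ.s≤s j≤k) = ℚ.+-monoʳ-≤ 1ℚ (ι-mono-≤ j≤k)

ι-½<ι : ∀ k → ι k ℚ.- ½ ℚ.< ι k
ι-½<ι k = subst (ι k ℚ.- ½ ℚ.<_) (ℚ.+-identityʳ (ι k)) (ℚ.+-monoʳ-< (ι k) (ℚ.negative⁻¹ (ℚ.- ½)))

ι<ι-½ : ∀ {j k} → j ℕ.< k → ι j ℚ.< ι k ℚ.- ½
ι<ι-½ {j} {k} j<k = ℚ.<-≤-trans
  (subst₂ ℚ._<_ (ℚ.+-identityˡ (ι j)) (regroup (ι j)) (ℚ.+-monoˡ-< (ι j) (ℚ.positive⁻¹ ½)))
  (ℚ.+-monoˡ-≤ (ℚ.- ½) (ι-mono-≤ j<k))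
  where
  regroup : ∀ p → ½ ℚ.+ p ≡ 1ℚ ℚ.+ p ℚ.- ½
  regroup = solve 1 (λ p → con ½ :+ p := con 1ℚ :+ p :- con ½) refl

costVector : ℕ → Vec (Subset n) k → Vector ℚ n
costVector N []       a = 0ℚ
costVector N (A ∷ As) a = indicator (∁ A) a ℚ.+ ι N ℚ.* costVector N As a

sum-indicators : ∀ (A B : Subset n) → (sumℚ λ a → indicator (∁ A) a ℚ.* indicator B a) ≡ ι ∣ B ─ A ∣
sum-indicators []            []            = refl
sum-indicators (inside  ∷ A) (outside ∷ B) = trans (ℚ.+-identityˡ _) (sum-indicators A B)
sum-indicators (inside  ∷ A) (inside  ∷ B) = trans (ℚ.+-identityˡ _) (sum-indicators A B)
sum-indicators (outside ∷ A) (outside ∷ B) = trans (ℚ.+-identityˡ _) (sum-indicators A B)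
sum-indicators (outside ∷ A) (inside  ∷ B) = cong (1ℚ ℚ.+_) (sum-indicators A B)

sum-costVector : ∀ N (As : Vec (Subset n) k) B →
  (sumℚ λ a → costVector N As a ℚ.* indicator B a) ≡ ι (cost N As B)
sum-costVector N []       B = sum-0* (indicator B)
sum-costVector N (A ∷ As) B = begin
  sumℚ (λ a → (indicator (∁ A) a ℚ.+ ι N ℚ.* ω a) ℚ.* indicator B a)
    ≡⟨ Σℚ.sum-cong-≗ (λ a → expand (indicator (∁ A) a) (ι N) (ω a) (indicator B a)) ⟩
  sumℚ (λ a → indicator (∁ A) a ℚ.* indicator B a ℚ.+ ι N ℚ.* (ω a ℚ.* indicator B a))
    ≡⟨ Σℚ.∑-distrib-+ (λ a → indicator (∁ A) a ℚ.* indicator B a) (λ a → ι N ℚ.* (ω a ℚ.* indicator B a)) ⟩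
  sumℚ (λ a → indicator (∁ A) a ℚ.* indicator B a) ℚ.+ sumℚ (λ a → ι N ℚ.* (ω a ℚ.* indicator B a))
    ≡⟨ cong₂ ℚ._+_ (sum-indicators A B) (trans
         (sym (Σℚ.*-distribˡ-sum (ι N) λ a → ω a ℚ.* indicator B a)) (cong (ι N ℚ.*_) (sum-costVector N As B))) ⟩
  ι ∣ B ─ A ∣ ℚ.+ ι N ℚ.* ι (cost N As B)
    ≡⟨ trans (ι-+ ∣ B ─ A ∣ _) (cong (ι ∣ B ─ A ∣ ℚ.+_) (ι-* N (cost N As B))) ⟨
  ι (cost N (A ∷ As) B) ∎
  where
  open ≡-Reasoning
  ω = costVector N As
  expand : ∀ i N w b → (i ℚ.+ N ℚ.* w) ℚ.* b ≡ i ℚ.* b ℚ.+ N ℚ.* (w ℚ.* b)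
  expand = solve 4 (λ i N w b → (i :+ N :* w) :* b := i :* b :+ N :* (w :* b)) refl

𝟏-yes : ∀ {P : Set} (d : Dec P) → P → 𝟏 d ≡ 1ℤ
𝟏-yes (yes _) _ = refl
𝟏-yes (no ¬p) p = contradiction p ¬p

𝟏-no : ∀ {P : Set} (d : Dec P) → ¬ P → 𝟏 d ≡ 0ℤ
𝟏-no (yes p) ¬p = contradiction p ¬p
𝟏-no (no _)  _  = refl

-- Passing from c - ½ to c, a slice of a polytope with integral first coordinates
-- appears exactly when c is their minimum.
nonempty-slice-jump : ∀ (V : List (Vector ℚ (suc d))) μ c →
  (∀ {v} → v ∈ V → ∃[ j ] (v zero ≡ ι j × μ ℕ.≤ j)) → ∃[ v ] (v ∈ V × v zero ≡ ι μ) →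
  nonempty (slice (ι c) V) ℤ.- nonempty (slice (ι c ℚ.- ½) V) ≡ 𝟏 (μ ℕ.≟ c)
nonempty-slice-jump V μ c integral (v₀ , v₀∈V , v₀≡) with ℕ.<-cmp μ c
... | tri> _ μ≢c c<μ = trans
        (cong₂ ℤ._-_ (nonempty-slice-below V λ v∈ → low v∈)
          (nonempty-slice-below V λ v∈ → ℚ.<-trans (ι-½<ι c) (low v∈)))
        (sym (𝟏-no (μ ℕ.≟ c) μ≢c))
  where
  low : ∀ {v} → v ∈ V → ι c ℚ.< v zero
  low v∈ = let j , v≡ , μ≤j = integral v∈ in
    subst (ι c ℚ.<_) (sym v≡) (ℚ.<-trans (ι<ι-½ (ℕ.<-≤-trans c<μ μ≤j)) (ι-½<ι j))
... | tri≈ _ refl _ = trans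
        (cong₂ ℤ._-_ (nonempty-slice≡1 v₀∈V v₀∈V (ℚ.≤-reflexive v₀≡) (ℚ.≤-reflexive (sym v₀≡)))
          (nonempty-slice-below V λ v∈ → let j , v≡ , μ≤j = integral v∈ in
            subst (ι c ℚ.- ½ ℚ.<_) (sym v≡) (ℚ.<-≤-trans (ι-½<ι c) (ι-mono-≤ μ≤j))))
        (sym (𝟏-yes (μ ℕ.≟ μ) refl))
-- The minimum lies to the left of both slices, so each is nonempty iff some generator reaches it.
-- No integer lies in the range from `c - ½` up to but excluding `c`, hence both are nonempty or
-- both are empty.
... | tri< μ<c μ≢c _ = trans (cancel (Any.any? (λ v → ι c ℚ.≤? v zero) V)) (sym (𝟏-no (μ ℕ.≟ c) μ≢c))
  where
  v₀< : v₀ zero ℚ.< ι c ℚ.- ½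
  v₀< = subst (ℚ._< ι c ℚ.- ½) (sym v₀≡) (ι<ι-½ μ<c)
  cancel : Dec (Any.Any (λ v → ι c ℚ.≤ v zero) V) →
    nonempty (slice (ι c) V) ℤ.- nonempty (slice (ι c ℚ.- ½) V) ≡ 0ℤ
  cancel (yes any) = let v , v∈V , c≤v = find any in cong₂ ℤ._-_
    (nonempty-slice≡1 v₀∈V v∈V (ℚ.<⇒≤ (ℚ.<-trans v₀< (ι-½<ι c))) c≤v)
    (nonempty-slice≡1 v₀∈V v∈V (ℚ.<⇒≤ v₀<) (ℚ.≤-trans (ℚ.<⇒≤ (ι-½<ι c)) c≤v))
  cancel (no none) = cong₂ ℤ._-_
    (nonempty-slice-above V λ v∈ → ℚ.<-trans (high v∈) (ι-½<ι c)) (nonempty-slice-above V high)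
    where
    high : ∀ {v} → v ∈ V → v zero ℚ.< ι c ℚ.- ½
    high {v} v∈ with integral v∈
    ... | j , v≡ , _ = subst (ℚ._< ι c ℚ.- ½) (sym v≡) (ι<ι-½ {j} {c} (ℕ.≰⇒> λ c≤j →
      none (Any.map (λ { refl → subst (ι c ℚ.≤_) (sym v≡) (ι-mono-≤ {c} {j} c≤j) }) v∈)))

-- The cancellation hypothesis accepts any decisions of membership; this supplies one whose value is
-- the computed indicator.
decision : ∀ {P : Set} {h} → (h ≡ 1ℤ × P) ⊎ (h ≡ 0ℤ × ¬ P) → ∃[ d ] 𝟏 {A = P} d ≡ h
decision (inj₁ (h≡1 , p))  = yes p , sym h≡1
decision (inj₂ (h≡0 , ¬p)) = no ¬p , sym h≡0

-- Cancellation of slices and of minimal costs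

module _ (M : Fin m → Matroid n) (c : Fin m → ℤ) (cancel : IndicatorsCancel M c) where

  hullIndicators-cancel : ∀ ω t x → combination c (λ i → hullIndicator (lifted (M i) ω) (t Fun.∷ x)) ≡ 0ℤ
  hullIndicators-cancel ω t x = split (t ℚ.≟ s)
    where
    s = sumℚ λ a → ω a ℚ.* x a
    split : Dec (t ≡ s) → combination c (λ i → hullIndicator (lifted (M i) ω) (t Fun.∷ x)) ≡ 0ℤ
    split (no t≢s) = trans
      (combination-cong c λ i → hullIndicator-lifted-≢ (M i) ω t x t≢s)
      (combination-0 c)
    split (yes t≡s) = begin
      combination c (λ i → hullIndicator (lifted (M i) ω) (t Fun.∷ x))
        ≡⟨ cong (λ t → combination c (λ i → hullIndicator (lifted (M i) ω) (t Fun.∷ x))) t≡s ⟩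
      combination c (λ i → hullIndicator (lifted (M i) ω) (s Fun.∷ x))
        ≡⟨ combination-cong c {g = λ i → 𝟏 (proj₁ (decided i))} (λ i → sym (proj₂ (decided i))) ⟩
      combination c (λ i → 𝟏 (proj₁ (decided i)))
        -- At rational points membership in every polytope has been decided, so the hypothesis can
        -- be used there.
        ≡⟨ cancel (constant ∘ x) (λ i → proj₁ (decided i)) ⟩
      0ℤ ∎
      where
      open ≡-Reasoning
      decided : ∀ i → ∃[ d ] 𝟏 {A = BasePolytope (M i) (constant ∘ x)} d ≡
        hullIndicator (lifted (M i) ω) (s Fun.∷ x)
      decided i = decision (hullIndicator-lifted (M i) ω x)

  -- The indicator of the lifted hull at `t Fun.∷ x` is by definition that of its slice at `x`, so
  -- the slices satisfy the hypothesis of the nonemptiness lemma.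
  slices-cancel : ∀ ω t → combination c (λ i → nonempty (slice t (lifted (M i) ω))) ≡ 0ℤ
  slices-cancel ω t = hullIndicators-cancel⇒nonempty-cancel (λ i → slice t (lifted (M i) ω)) c
    (hullIndicators-cancel ω t)

  minimal-costs-cancel : ∀ N {As : Vec (Subset n) k} → Linked _⊆_ As → ∀ e →
    combination c (λ i → 𝟏 (minimal-cost (M i) N As ℕ.≟ e)) ≡ 0ℤ
  minimal-costs-cancel N {As} linked e = begin
    combination c (λ i → 𝟏 (minimal-cost (M i) N As ℕ.≟ e))
      ≡⟨ combination-cong c {λ i → nonempty (slice (ι e) (V i)) ℤ.- nonempty (slice (ι e ℚ.- ½) (V i))}
           jump ⟨
    combination c (λ i → nonempty (slice (ι e) (V i)) ℤ.- nonempty (slice (ι e ℚ.- ½) (V i)))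
      ≡⟨ combination-minus c (λ i → nonempty (slice (ι e) (V i))) (λ i → nonempty (slice (ι e ℚ.- ½) (V i))) ⟩
    combination c (λ i → nonempty (slice (ι e) (V i))) ℤ.-
    combination c (λ i → nonempty (slice (ι e ℚ.- ½) (V i)))
      ≡⟨ cong₂ ℤ._-_ (slices-cancel ω (ι e)) (slices-cancel ω (ι e ℚ.- ½)) ⟩
    0ℤ ∎
    where
    open ≡-Reasoning
    ω = costVector N As
    V = λ i → lifted (M i) ω
    point : Subset n → Vector ℚ (suc n)
    point B = (sumℚ λ a → ω a ℚ.* indicator B a) Fun.∷ indicator B
    integral : ∀ i {v} → v ∈ V i → ∃[ j ] (v zero ≡ ι j × minimal-cost (M i) N As ℕ.≤ j)
    integral i v∈ = let B , B∈ , v≡ = ∈-map⁻ point v∈ in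
      cost N As B , trans (cong (λ v → v zero) v≡) (sum-costVector N As B)
      , minimal-cost≤cost (M i) N As (∈-bases⁻ (M i) B∈)
    attained : ∀ i → ∃[ v ] (v ∈ V i × v zero ≡ ι (minimal-cost (M i) N As))
    attained i = let B , basis , cost≡ = minimal-cost-attained (M i) N linked in
      point B , ∈-map⁺ point (∈-bases⁺ (M i) basis) , trans (sum-costVector N As B) (cong ι cost≡)
    jump : ∀ i → nonempty (slice (ι e) (V i)) ℤ.- nonempty (slice (ι e ℚ.- ½) (V i)) ≡
      𝟏 (minimal-cost (M i) N As ℕ.≟ e)
    jump i = nonempty-slice-jump (V i) (minimal-cost (M i) N As) e (integral i) (attained i)

-- Coefficients of the chain characteristic polynomial

monomial : ℤ → Vec ℕ k → Poly k
monomial c e = (c , e) ∷ []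

_⊕_ : Vec ℕ k → Vec ℕ k → Vec ℕ k
_⊕_ = Vec.zipWith ℕ._+_

zeros : Vec ℕ k
zeros = Vec.replicate _ 0

⊕-identityˡ : ∀ (v : Vec ℕ k) → zeros ⊕ v ≡ v
⊕-identityˡ = Vec.zipWith-identityˡ ℕ.+-identityˡ

⊕-[]≔ : ∀ (i : Fin k) p q → (zeros Vec.[ i ]≔ p) ⊕ (zeros Vec.[ i ]≔ q) ≡ zeros Vec.[ i ]≔ (p ℕ.+ q)
⊕-[]≔ zero    p q = cong (p ℕ.+ q ∷_) (⊕-identityˡ zeros)
⊕-[]≔ (suc i) p q = cong (0 ∷_) (⊕-[]≔ i p q)

[]≔0 : ∀ (i : Fin k) → zeros Vec.[ i ]≔ 0 ≡ zeros
[]≔0 zero    = refl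
[]≔0 (suc i) = cong (0 ∷_) ([]≔0 i)

var-^ : ∀ (i : Fin k) p → var i ^ᵖ p ≡ monomial 1ℤ (zeros Vec.[ i ]≔ p)
var-^ i zero    = cong (monomial 1ℤ) (sym ([]≔0 i))
var-^ i (suc p) = trans (cong (var i *ᵖ_) (var-^ i p)) (cong (monomial 1ℤ) (⊕-[]≔ i 1 p))

const-*-var-^ : ∀ c (i : Fin k) p → constᵖ c *ᵖ var i ^ᵖ p ≡ monomial c (zeros Vec.[ i ]≔ p)
const-*-var-^ c i p = trans (cong (constᵖ c *ᵖ_) (var-^ i p))
  (cong₂ monomial (ℤ.*-identityʳ c) (⊕-identityˡ _))

prod-monomial : ∀ {p : Fin m → Poly k} (c : Fin m → ℤ) (e : Fin m → Vec ℕ k) →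
  (∀ i → p i ≡ monomial (c i) (e i)) →
  prodᵖ p ≡ monomial (Fun.foldr ℤ._*_ 1ℤ c) (Fun.foldr _⊕_ zeros e)
prod-monomial {zero}  c e p≡ = refl
prod-monomial {suc m} c e p≡ = cong₂ _*ᵖ_ (p≡ zero) (prod-monomial (c ∘ suc) (e ∘ suc) (p≡ ∘ suc))

⊕-sum-∷ : ∀ (e : Fin m → Vec ℕ k) → Fun.foldr _⊕_ zeros (λ i → 0 ∷ e i) ≡ 0 ∷ Fun.foldr _⊕_ zeros e
⊕-sum-∷ {zero}  e = refl
⊕-sum-∷ {suc m} e = cong ((0 ∷ e zero) ⊕_) (⊕-sum-∷ (e ∘ suc))

⊕-sum-units : ∀ (r : Fin k → ℕ) → Fun.foldr _⊕_ zeros (λ i → zeros Vec.[ i ]≔ r i) ≡ Vec.tabulate r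
⊕-sum-units {zero}  r = refl
⊕-sum-units {suc k} r = trans (cong ((r zero ∷ zeros) ⊕_) (⊕-sum-∷ λ i → zeros Vec.[ i ]≔ r (suc i)))
  (cong₂ _∷_ (ℕ.+-identityʳ (r zero)) (trans (⊕-identityˡ _) (⊕-sum-units (r ∘ suc))))

-- This agrees definitionally with the local `term` of `chainCharPoly`.
chainTerm : Matroid n → Vec (Subset n) k → Poly k
chainTerm M A = prodᵖ λ i → constᵖ (-1ℤ ℤ.^ ∣ lookup A i ∣) *ᵖ var i ^ᵖ corank M (lookup A i)

chainSign : Vec (Subset n) k → ℤ
chainSign {k = k} A = Fun.foldr ℤ._*_ 1ℤ {n = k} λ i → -1ℤ ℤ.^ ∣ lookup A i ∣

-- Each factor reduces to a list with a single term and so does their product, which makes this an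
-- equality of representations rather than of coefficients only.
chainTerm-monomial : ∀ (M : Matroid n) (A : Vec (Subset n) k) →
  chainTerm M A ≡ monomial (chainSign A) (Vec.map (corank M) A)
chainTerm-monomial M A = trans
  (prod-monomial (λ i → -1ℤ ℤ.^ ∣ lookup A i ∣) (λ i → zeros Vec.[ i ]≔ corank M (lookup A i))
    λ i → const-*-var-^ _ i (corank M (lookup A i)))
  (cong (monomial (chainSign A)) (trans (⊕-sum-units (corank M ∘ lookup A))
    (trans (Vec.tabulate-∘ (corank M) (lookup A)) (cong (Vec.map (corank M)) (Vec.tabulate∘lookup A)))))

coeff-· : ∀ z (p : Poly k) e → coeff (_·_ (polyAbelianGroup k) z p) e ≡ z ℤ.* coeff p e
coeff-· {k} (+ n)    p e = natural n
  where
  natural : ∀ n → coeff (_·_ (polyAbelianGroup k) (+ n) p) e ≡ + n ℤ.* coeff p e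
  natural zero    = refl
  natural (suc n) = trans (coeff-+ p _ e) (trans (cong (ℤ._+_ (coeff p e)) (natural n))
    (sym (ℤ.suc-* (+ n) (coeff p e))))
coeff-· {k} -[1+ n ] p e = trans (coeff-neg (_·_ (polyAbelianGroup k) (+ suc n) p) e)
  (trans (cong ℤ.-_ (coeff-· (+ suc n) p e)) (ℤ.neg-distribˡ-* (+ suc n) (coeff p e)))

coeff-sum : ∀ (p : Fin m → Poly k) e → coeff (Fun.foldr _+ᵖ_ 0ᵖ p) e ≡ Σℤ.sum λ i → coeff (p i) e
coeff-sum {zero}  p e = refl
coeff-sum {suc m} p e = trans (coeff-+ (p zero) _ e) (cong (ℤ._+_ (coeff (p zero) e)) (coeff-sum (p ∘ suc) e))

combination-coeff-foldr : ∀ {a} {A : Set a} (c : Fin m → ℤ) (t : Fin m → A → Poly k) xs e →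
  (∀ {x} → x ∈ xs → combination c (λ i → coeff (t i x) e) ≡ 0ℤ) →
  combination c (λ i → coeff (List.foldr _+ᵖ_ 0ᵖ (List.map (t i) xs)) e) ≡ 0ℤ
combination-coeff-foldr c t []       e terms≡0 = combination-0 c
combination-coeff-foldr c t (x ∷ xs) e terms≡0 = trans
  (combination-cong c λ i → coeff-+ (t i x) _ e)
  (trans (combination-+ c _ _) (cong₂ ℤ._+_ (terms≡0 (here refl))
    (combination-coeff-foldr c t xs e λ x∈ → terms≡0 (there x∈))))

lookup≤sum : ∀ (e : Vec ℕ k) → VecAll.All (ℕ._≤ Vec.sum e) e
lookup≤sum []      = []
lookup≤sum (x ∷ e) = ℕ.m≤m+n x _ ∷ VecAll.map (λ ≤sum → ℕ.≤-trans ≤sum (ℕ.m≤n+m _ x)) (lookup≤sum e)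

-- Coranks are at most `n` and exponents at most `Vec.sum e`, so `N` exceeds all entries on both
-- sides and equal numbers have equal digits. `N` may depend on `e` because coefficients are treated
-- one at a time.
coeff-chainTerm : ∀ (M : Matroid n) (As : Vec (Subset n) k) e → let N = suc (n ℕ.+ Vec.sum e) in
  coeff (chainTerm M As) e ≡ 𝟏 (minimal-cost M N As ℕ.≟ digits N e) ℤ.* chainSign As
coeff-chainTerm {n} M As e = trans (cong (λ p → coeff p e) (chainTerm-monomial M As))
  (trans (ℤ.+-identityʳ _) (compare (Vec.≡-dec ℕ._≟_ (Vec.map (corank M) As) e) (minimal-cost M N As ℕ.≟ digits N e)))
  where
  N = suc (n ℕ.+ Vec.sum e)
  compare : (p : Dec (Vec.map (corank M) As ≡ e)) (q : Dec (minimal-cost M N As ≡ digits N e)) →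
    (if does p then chainSign As else 0ℤ) ≡ 𝟏 q ℤ.* chainSign As
  compare (yes _)  (yes _) = sym (ℤ.*-identityˡ (chainSign As))
  compare (no _)   (no _)  = sym (ℤ.*-zeroˡ (chainSign As))
  compare (yes eq) (no ≢)  = contradiction (cong (digits N) eq) ≢
  compare (no ≢)   (yes eq) = contradiction (digits-injective N
    (VecAll.map (λ r≤n → ℕ.s≤s (ℕ.≤-trans r≤n (ℕ.m≤m+n n _))) (VecAll.map⁺ (VecAll.universal (corank≤n M) As)))
    (VecAll.map (λ e≤ → ℕ.s≤s (ℕ.≤-trans e≤ (ℕ.m≤n+m _ n))) (lookup≤sum e)) eq) ≢

corollary1p5 : (k : ℕ) → 1 ≤ k → IsMatroidValuation (polyAbelianGroup k) (chainCharPoly k)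
corollary1p5 k _ n m M c cancel e = begin
  coeff (Fun.foldr _+ᵖ_ 0ᵖ (λ i → _·_ (polyAbelianGroup k) (c i) (chainCharPoly k (M i)))) e
    ≡⟨ coeff-sum (λ i → _·_ (polyAbelianGroup k) (c i) (chainCharPoly k (M i))) e ⟩
  Σℤ.sum (λ i → coeff (_·_ (polyAbelianGroup k) (c i) (chainCharPoly k (M i))) e)
    ≡⟨ Σℤ.sum-cong-≗ (λ i → coeff-· (c i) (chainCharPoly k (M i)) e) ⟩
  combination c (λ i → coeff (chainCharPoly k (M i)) e)
    -- The list of chains is the same for all matroids on the ground set, so it suffices to cancel
    -- the terms of one chain.
    ≡⟨ combination-coeff-foldr c (λ i → chainTerm (M i)) (chains k n) e vanishes ⟩
  0ℤ ∎
  where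
  open ≡-Reasoning
  vanishes : ∀ {As} → As ∈ chains k n → combination c (λ i → coeff (chainTerm (M i) As) e) ≡ 0ℤ
  vanishes {As} As∈ = begin
    combination c (λ i → coeff (chainTerm (M i) As) e)
      ≡⟨ combination-cong c (λ i → coeff-chainTerm (M i) As e) ⟩
    combination c (λ i → 𝟏 (minimal-cost (M i) N As ℕ.≟ digits N e) ℤ.* chainSign As)
      -- The sign depends on the chain alone and factors out.
      ≡⟨ combination-*ʳ c (λ i → 𝟏 (minimal-cost (M i) N As ℕ.≟ digits N e)) (chainSign As) ⟩
    combination c (λ i → 𝟏 (minimal-cost (M i) N As ℕ.≟ digits N e)) ℤ.* chainSign As
      ≡⟨ cong (ℤ._* chainSign As) (minimal-costs-cancel M c cancel N linked (digits N e)) ⟩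
    0ℤ ℤ.* chainSign As
      ≡⟨ ℤ.*-zeroˡ (chainSign As) ⟩
    0ℤ ∎
    where
    N = suc (n ℕ.+ Vec.sum e)
    linked : Linked _⊆_ As
    linked = proj₂ (∈-filter⁻ (linked? _⊆?_) {xs = vectorsOver (subsets n) k} As∈)
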